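{- Let $\mathcal{M}_i=(E_i,\rho_i)$, $i=1,2$, be $q$-matroids and $E=E_1\oplus E_2$. Choose non-degenerate symmetric bilinear forms $\langle\cdot,\cdot\rangle_i$ on $E_i$ and define $\langle v_1+v_2,w_1+w_2\rangle=\langle v_1,w_1\rangle_1+\langle v_2,w_2\rangle_2$ for $v_i,w_i\in E_i$. Then $\langle\cdot,\cdot\rangle$ is a non-degenerate symmetric bilinear form on $E$ and \[ (\mathcal{M}_1\oplus\mathcal{M}_2)^*=\mathcal{M}_1^*\oplus\mathcal{M}_2^*, \] where $\mathcal{M}_i^*$ is the dual with respect to $\langle\cdot,\cdot\rangle_i$ and $(\mathcal{M}_1\oplus\mathcal{M}_2)^*$ the dual with respect to $\langle\cdot,\cdot\rangle$.
   Context: Let $\mathbb{F}=\mathbb{F}_q$. A $q$-matroid is $\mathcal{M}=(E,\rho)$, $E$ a finite-dimensional $\mathbb{F}$-vector space, $\rho$ from subspaces to $\mathbb{Z}_{\ge0}$ with $0\le\rho(V)\le\dim V$, monotone and submodular. Given a non-degenerate symmetric bilinear form on $E$ with orthogonal spaces $V^\perp$, the dual of $\mathcal{M}$ is $\mathcal{M}^*=(E,\rho^*)$ with $\rho^*(V)=\dim V+\rho(V^\perp)-\rho(E)$. Direct sum: for $E=E_1\oplus E_2$ with projections $\pi_i:E\to E_i$, $\mathcal{M}_1\oplus\mathcal{M}_2=(E,\rho)$ where $\rho(V)=\dim V+\min_{X\le V}(\rho_1(\pi_1(X))+\rho_2(\pi_2(X))-\dim X)$. -}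

module Defs where

open import Algebra.Bundles using (CommutativeRing; CommutativeMonoid)
open import Algebra.Module.Bundles using (Module)
open import Algebra.Module.Construct.DirectProduct using (⟨module⟩)
open import Algebra.Module.Morphism.Structures using (module ModuleMorphisms)
import Algebra.Properties.AbelianGroup as AbelianGroupProperties
import Algebra.Properties.CommutativeMonoid.Sum as Sum
import Algebra.Properties.CommutativeSemigroup as CommutativeSemigroupProperties
open import Data.Fin.Base using (Fin; zero; suc; finToFun; funToFin; splitAt; join; _↑ˡ_; _↑ʳ_)
open import Data.Fin.Properties using (any?; all?; finToFun-funToFin; inj⇒≟; join-splitAt)
open import Data.Integer.Base using (ℤ; 0ℤ) renaming (+_ to pos; _+_ to _+ᶻ_; _-_ to _-ᶻ_; _≤_ to _≤ᶻ_)
open import Data.Integer.Properties using (≤-totalOrder)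
open import Data.List.Base using (List; []; _∷_; map; filter; tabulate)
open import Data.List.Extrema ≤-totalOrder using (min)
open import Data.List.Membership.Propositional using () renaming (_∈_ to _∈ˡ_)
open import Data.List.Membership.Propositional.Properties using (∈-tabulate⁺)
open import Data.List.Relation.Unary.All as All using (All; []; _∷_)
open import Data.List.Relation.Unary.All.Properties using (tabulate⁻)
open import Data.Nat.Base using (ℕ; zero; suc; _^_) renaming (_+_ to _+ℕ_)
open import Data.Product.Base using (Σ; ∃; _×_; _,_; proj₁; proj₂)
open import Data.Sum.Base using (inj₁; inj₂)
open import Data.Sum.Properties using ([,]-map)
open import Data.Unit.Base using (⊤; tt)
open import Data.Vec.Functional as Vector using (Vector)
open import Data.Vec.Functional.Properties using (lookup-++ˡ; lookup-++ʳ)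
open import Function.Base using (_∘_)
open import Function.Bundles using (Inverse)
open import Function.Properties.Inverse using (Inverse⇒Injection)
open import Level using (0ℓ)
open import Relation.Binary.Definitions using (_Respects_; Decidable)
open import Relation.Binary.PropositionalEquality.Core as ≡ using (_≡_)
open import Relation.Binary.PropositionalEquality.Properties using () renaming (setoid to ≡-setoid)
import Relation.Binary.Reasoning.Setoid as SetoidReasoning
open import Relation.Nullary using (¬_; Dec; yes; no; contradiction)
open import Relation.Nullary.Decidable using (_×-dec_; _→-dec_) renaming (map′ to mapDec)
open import Relation.Unary using (Pred) renaming (Decidable to Decidable₁)

record FiniteField : Set₁ where
  field
    commutativeRing : CommutativeRing 0ℓ 0ℓ

  open CommutativeRing commutativeRing public hiding (zero)

  field
    1≉0         : ¬ 1# ≈ 0#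
    inverse     : ∀ x → ¬ x ≈ 0# → ∃ λ y → x * y ≈ 1#
    order       : ℕ
    enumeration : Inverse setoid (≡-setoid (Fin order))

  _≈?_ : Decidable _≈_
  _≈?_ = inj⇒≟ (Inverse⇒Injection enumeration)

  -- All q ^ k coefficient vectors of length k.
  coefficients : ∀ {k} → Fin (order ^ k) → Vector Carrier k
  coefficients i = Inverse.from enumeration ∘ finToFun i

  coefficients-surjective : ∀ {k} (c : Vector Carrier k) → ∃ λ i → ∀ j → coefficients i j ≈ c j
  coefficients-surjective c = funToFin (Inverse.to enumeration ∘ c) , λ j →
    trans (Inverse.from-cong enumeration (finToFun-funToFin (Inverse.to enumeration ∘ c) j))
          (Inverse.strictlyInverseʳ enumeration (c j))

module LinearCombinations (F : FiniteField) (M : Module (FiniteField.commutativeRing F) 0ℓ 0ℓ) where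
  open FiniteField F
  open Module M
  open Sum +ᴹ-commutativeMonoid using (sum; sum-cong-≋; ∑-distrib-+; sum-replicate-zero)
  open SetoidReasoning ≈ᴹ-setoid

  lincomb : ∀ {k} → Vector Carrier k → Vector Carrierᴹ k → Carrierᴹ
  lincomb c v = sum (λ i → c i *ₗ v i)

  InSpan : ∀ {k} → Vector Carrierᴹ k → Carrierᴹ → Set
  InSpan {k} v x = Σ (Vector Carrier k) λ c → lincomb c v ≈ᴹ x

  LinearlyIndependent : ∀ {k} → Vector Carrierᴹ k → Set
  LinearlyIndependent v = ∀ c → lincomb c v ≈ᴹ 0ᴹ → ∀ i → c i ≈ 0#

  lincomb-cong : ∀ {k} {c d : Vector Carrier k} {v w : Vector Carrierᴹ k} →
    (∀ i → c i ≈ d i) → (∀ i → v i ≈ᴹ w i) → lincomb c v ≈ᴹ lincomb d w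
  lincomb-cong c≈d v≈w = sum-cong-≋ λ i → *ₗ-cong (c≈d i) (v≈w i)

  lincomb-+ : ∀ {k} (c d : Vector Carrier k) v →
    lincomb (λ i → c i + d i) v ≈ᴹ lincomb c v +ᴹ lincomb d v
  lincomb-+ c d v = ≈ᴹ-trans
    (sum-cong-≋ λ i → *ₗ-distribʳ (v i) (c i) (d i))
    (∑-distrib-+ (λ i → c i *ₗ v i) (λ i → d i *ₗ v i))

  lincomb-* : ∀ {k} a (c : Vector Carrier k) v →
    lincomb (λ i → a * c i) v ≈ᴹ a *ₗ lincomb c v
  lincomb-* {zero}  a c v = ≈ᴹ-sym (*ₗ-zeroʳ a)
  lincomb-* {suc k} a c v = begin
    (a * c zero) *ₗ v zero +ᴹ lincomb (λ i → a * c (suc i)) (v ∘ suc)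
      ≈⟨ +ᴹ-cong (*ₗ-assoc a (c zero) (v zero)) (lincomb-* a (c ∘ suc) (v ∘ suc)) ⟩
    a *ₗ (c zero *ₗ v zero) +ᴹ a *ₗ lincomb (c ∘ suc) (v ∘ suc)
      ≈⟨ *ₗ-distribˡ a _ _ ⟨
    a *ₗ (c zero *ₗ v zero +ᴹ lincomb (c ∘ suc) (v ∘ suc)) ∎

  lincomb-0 : ∀ {k} (v : Vector Carrierᴹ k) → lincomb (λ _ → 0#) v ≈ᴹ 0ᴹ
  lincomb-0 {k} v = ≈ᴹ-trans (sum-cong-≋ λ i → *ₗ-zeroˡ (v i)) (sum-replicate-zero k)

  InSpan-resp : ∀ {k} {v : Vector Carrierᴹ k} → InSpan v Respects _≈ᴹ_
  InSpan-resp x≈y (c , p) = c , ≈ᴹ-trans p x≈y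

  InSpan-+ : ∀ {k} {v : Vector Carrierᴹ k} {x y} → InSpan v x → InSpan v y → InSpan v (x +ᴹ y)
  InSpan-+ {v = v} (c , p) (d , q) =
    (λ i → c i + d i) , ≈ᴹ-trans (lincomb-+ c d v) (+ᴹ-cong p q)

  InSpan-* : ∀ {k} {v : Vector Carrierᴹ k} a {x} → InSpan v x → InSpan v (a *ₗ x)
  InSpan-* {v = v} a (c , p) =
    (λ i → a * c i) , ≈ᴹ-trans (lincomb-* a c v) (*ₗ-congˡ p)

  InSpan-0 : ∀ {k} {v : Vector Carrierᴹ k} → InSpan v 0ᴹ
  InSpan-0 {v = v} = (λ _ → 0#) , lincomb-0 v

  InSpan-∷ : ∀ {k} {v : Vector Carrierᴹ k} {y x} → InSpan v x → InSpan (y Vector.∷ v) x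
  InSpan-∷ {v = v} {y} (c , p) =
    (0# Vector.∷ c) , ≈ᴹ-trans (+ᴹ-cong (*ₗ-zeroˡ y) p) (+ᴹ-identityˡ _)

  InSpan-head : ∀ {k} {v : Vector Carrierᴹ k} {y} → InSpan (y Vector.∷ v) y
  InSpan-head {v = v} {y} =
    (1# Vector.∷ λ _ → 0#) , ≈ᴹ-trans (+ᴹ-cong (*ₗ-identityˡ y) (lincomb-0 v)) (+ᴹ-identityʳ y)

  InSpan-member : ∀ {k} (v : Vector Carrierᴹ k) i → InSpan v (v i)
  InSpan-member v zero    = InSpan-head
  InSpan-member v (suc i) = InSpan-∷ (InSpan-member (v ∘ suc) i)

  -1*x≈-x : ∀ x → (- 1#) *ₗ x +ᴹ x ≈ᴹ 0ᴹ
  -1*x≈-x x = begin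
    (- 1#) *ₗ x +ᴹ x        ≈⟨ +ᴹ-congˡ (*ₗ-identityˡ x) ⟨
    (- 1#) *ₗ x +ᴹ 1# *ₗ x  ≈⟨ *ₗ-distribʳ x (- 1#) 1# ⟨
    (- 1# + 1#) *ₗ x        ≈⟨ *ₗ-congʳ (-‿inverseˡ 1#) ⟩
    0# *ₗ x                 ≈⟨ *ₗ-zeroˡ x ⟩
    0ᴹ                      ∎

  independent-∷ : ∀ {k} {v : Vector Carrierᴹ k} {x} →
    LinearlyIndependent v → ¬ InSpan v x → LinearlyIndependent (x Vector.∷ v)
  independent-∷ {k} {v} {x} indep x∉ c eq = λ where
      zero    → c₀≈0
      (suc i) → indep (c ∘ suc) tail≈0 i
    where
    T : Carrierᴹ
    T = lincomb (c ∘ suc) v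

    unit⇒InSpan : ∀ y → c zero * y ≈ 1# → InSpan v x
    unit⇒InSpan y cy≈1 = InSpan-resp (begin
      z *ₗ T                                   ≈⟨ +ᴹ-identityˡ _ ⟨
      0ᴹ +ᴹ z *ₗ T                             ≈⟨ +ᴹ-congʳ (≈ᴹ-trans (+ᴹ-comm _ _) (-1*x≈-x x)) ⟨
      (x +ᴹ (- 1#) *ₗ x) +ᴹ z *ₗ T             ≈⟨ +ᴹ-assoc _ _ _ ⟩
      x +ᴹ ((- 1#) *ₗ x +ᴹ z *ₗ T)             ≈⟨ +ᴹ-congˡ (+ᴹ-congʳ (*ₗ-congʳ zc≈-1)) ⟨
      x +ᴹ ((z * c zero) *ₗ x +ᴹ z *ₗ T)       ≈⟨ +ᴹ-congˡ (+ᴹ-congʳ (*ₗ-assoc z (c zero) x)) ⟩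
      x +ᴹ (z *ₗ (c zero *ₗ x) +ᴹ z *ₗ T)      ≈⟨ +ᴹ-congˡ (*ₗ-distribˡ z _ _) ⟨
      x +ᴹ z *ₗ (c zero *ₗ x +ᴹ T)             ≈⟨ +ᴹ-congˡ (*ₗ-congˡ eq) ⟩
      x +ᴹ z *ₗ 0ᴹ                             ≈⟨ +ᴹ-congˡ (*ₗ-zeroʳ z) ⟩
      x +ᴹ 0ᴹ                                  ≈⟨ +ᴹ-identityʳ x ⟩
      x                                        ∎)
      (InSpan-* z (c ∘ suc , ≈ᴹ-refl))
      where
      z : Carrier
      z = (- 1#) * y
      zc≈-1 : z * c zero ≈ - 1#
      zc≈-1 = trans (*-assoc (- 1#) y (c zero))
        (trans (*-congˡ (trans (*-comm y (c zero)) cy≈1)) (*-identityʳ (- 1#)))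

    c₀≈0 : c zero ≈ 0#
    c₀≈0 with c zero ≈? 0#
    ... | yes p = p
    ... | no ¬p = contradiction
      (unit⇒InSpan (proj₁ (inverse (c zero) ¬p)) (proj₂ (inverse (c zero) ¬p))) x∉

    tail≈0 : T ≈ᴹ 0ᴹ
    tail≈0 = begin
      T                    ≈⟨ +ᴹ-identityˡ T ⟨
      0ᴹ +ᴹ T              ≈⟨ +ᴹ-congʳ (≈ᴹ-trans (*ₗ-congʳ c₀≈0) (*ₗ-zeroˡ x)) ⟨
      c zero *ₗ x +ᴹ T     ≈⟨ eq ⟩
      0ᴹ                   ∎

  lincomb-++ : ∀ {j k} (c : Vector Carrier (j +ℕ k)) (v : Vector Carrierᴹ j) (w : Vector Carrierᴹ k) →
    lincomb c (v Vector.++ w) ≈ᴹ lincomb (c ∘ (_↑ˡ k)) v +ᴹ lincomb (c ∘ (j ↑ʳ_)) w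
  lincomb-++ {zero}      c v w = ≈ᴹ-sym (+ᴹ-identityˡ _)
  lincomb-++ {suc j} {k} c v w = begin
    c zero *ₗ v zero +ᴹ lincomb (c ∘ suc) ((v Vector.++ w) ∘ suc)
      ≈⟨ +ᴹ-congˡ (lincomb-cong (λ _ → refl) (λ i → ≈ᴹ-reflexive ([,]-map (splitAt j i)))) ⟩
    c zero *ₗ v zero +ᴹ lincomb (c ∘ suc) ((v ∘ suc) Vector.++ w)
      ≈⟨ +ᴹ-congˡ (lincomb-++ (c ∘ suc) (v ∘ suc) w) ⟩
    c zero *ₗ v zero +ᴹ (lincomb (c ∘ suc ∘ (_↑ˡ k)) (v ∘ suc) +ᴹ lincomb (c ∘ suc ∘ (j ↑ʳ_)) w)
      ≈⟨ +ᴹ-assoc _ _ _ ⟨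
    lincomb (c ∘ (_↑ˡ k)) v +ᴹ lincomb (c ∘ (suc j ↑ʳ_)) w ∎

record VectorSpace (F : FiniteField) : Set₁ where
  open FiniteField F
  field
    vectors : Module commutativeRing 0ℓ 0ℓ

  open Module vectors public
  open LinearCombinations F vectors public

  field
    {dimension}       : ℕ
    basis             : Vector Carrierᴹ dimension
    basis-independent : LinearlyIndependent basis
    basis-spans       : ∀ x → InSpan basis x

  size : ℕ
  size = order ^ dimension

  element : Fin size → Carrierᴹ
  element i = lincomb (coefficients i) basis

  element-surjective : ∀ x → ∃ λ i → element i ≈ᴹ x
  element-surjective x with basis-spans x
  ... | c , p with coefficients-surjective c
  ... | i , q = i , ≈ᴹ-trans (lincomb-cong q (λ _ → ≈ᴹ-refl)) p

  ∃? : {P : Pred Carrierᴹ 0ℓ} → P Respects _≈ᴹ_ → Decidable₁ P → Dec (∃ P)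
  ∃? resp P? = mapDec
    (λ (i , p) → element i , p)
    (λ (x , p) → let (i , e) = element-surjective x in i , resp (≈ᴹ-sym e) p)
    (any? (P? ∘ element))

  ∀? : {P : Pred Carrierᴹ 0ℓ} → P Respects _≈ᴹ_ → Decidable₁ P → Dec (∀ x → P x)
  ∀? resp P? = mapDec
    (λ f x → let (i , e) = element-surjective x in resp e (f i))
    (λ f i → f (element i))
    (all? (P? ∘ element))

  _≈ᴹ?_ : Decidable _≈ᴹ_
  x ≈ᴹ? y with basis-spans (x +ᴹ -ᴹ y)
  ... | c , p = mapDec
    (λ c≈0 → x∙y⁻¹≈ε⇒x≈y x y (≈ᴹ-trans (≈ᴹ-sym p)
      (≈ᴹ-trans (lincomb-cong c≈0 (λ _ → ≈ᴹ-refl)) (lincomb-0 basis))))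
    (λ x≈y → basis-independent c (≈ᴹ-trans p (x≈y⇒x∙y⁻¹≈ε x≈y)))
    (all? λ i → c i ≈? 0#)
    where open AbelianGroupProperties +ᴹ-abelianGroup using (x∙y⁻¹≈ε⇒x≈y; x≈y⇒x∙y⁻¹≈ε)

  InSpan? : ∀ {k} (v : Vector Carrierᴹ k) → Decidable₁ (InSpan v)
  InSpan? v x = mapDec
    (λ (i , p) → coefficients i , p)
    (λ (c , p) → let (i , q) = coefficients-surjective c in
      i , ≈ᴹ-trans (lincomb-cong q (λ _ → ≈ᴹ-refl)) p)
    (any? λ i → lincomb (coefficients i) v ≈ᴹ? x)

module _ {F : FiniteField} where
  open FiniteField F using (0#; _≈_; _+_; _*_; _≈?_)

  infixr 6 _⊕ⱽ_

  _⊕ⱽ_ : VectorSpace F → VectorSpace F → VectorSpace F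
  E₁ ⊕ⱽ E₂ = record
    { vectors           = ⟨module⟩ E₁.vectors E₂.vectors
    ; basis             = b
    ; basis-independent = λ c eq i → ≡.subst (λ j → c j ≈ 0#) (join-splitAt n₁ n₂ i)
        (independent c (E.≈ᴹ-trans (E.≈ᴹ-sym (lincomb-b c)) eq) (splitAt n₁ i))
    ; basis-spans       = λ (x , y) → spans (E₁.basis-spans x) (E₂.basis-spans y)
    }
    where
    module F = FiniteField F
    module E₁ = VectorSpace E₁
    module E₂ = VectorSpace E₂
    module E where
      open Module (⟨module⟩ E₁.vectors E₂.vectors) public
      open LinearCombinations F (⟨module⟩ E₁.vectors E₂.vectors) public
    n₁ = E₁.dimension
    n₂ = E₂.dimension

    inl : Vector E.Carrierᴹ n₁
    inl i = E₁.basis i , E₂.0ᴹ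

    inr : Vector E.Carrierᴹ n₂
    inr i = E₁.0ᴹ , E₂.basis i

    b : Vector E.Carrierᴹ (n₁ +ℕ n₂)
    b = inl Vector.++ inr

    lincomb-× : ∀ {k} (c : Vector F.Carrier k) (v : Vector E.Carrierᴹ k) →
      E.lincomb c v E.≈ᴹ (E₁.lincomb c (proj₁ ∘ v) , E₂.lincomb c (proj₂ ∘ v))
    lincomb-× {zero}  c v = E.≈ᴹ-refl
    lincomb-× {suc k} c v =
      E.+ᴹ-cong {c zero E.*ₗ v zero} E.≈ᴹ-refl (lincomb-× (c ∘ suc) (v ∘ suc))

    lincomb-0₁ : ∀ {k} (c : Vector F.Carrier k) → E₁.lincomb c (λ _ → E₁.0ᴹ) E₁.≈ᴹ E₁.0ᴹ
    lincomb-0₁ {zero}  c = E₁.≈ᴹ-refl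
    lincomb-0₁ {suc k} c =
      E₁.≈ᴹ-trans (E₁.+ᴹ-cong (E₁.*ₗ-zeroʳ (c zero)) (lincomb-0₁ (c ∘ suc))) (E₁.+ᴹ-identityˡ _)

    lincomb-0₂ : ∀ {k} (c : Vector F.Carrier k) → E₂.lincomb c (λ _ → E₂.0ᴹ) E₂.≈ᴹ E₂.0ᴹ
    lincomb-0₂ {zero}  c = E₂.≈ᴹ-refl
    lincomb-0₂ {suc k} c =
      E₂.≈ᴹ-trans (E₂.+ᴹ-cong (E₂.*ₗ-zeroʳ (c zero)) (lincomb-0₂ (c ∘ suc))) (E₂.+ᴹ-identityˡ _)

    lincomb-b : ∀ c → E.lincomb c b E.≈ᴹ
      (E₁.lincomb (c ∘ (_↑ˡ n₂)) E₁.basis , E₂.lincomb (c ∘ (n₁ ↑ʳ_)) E₂.basis)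
    lincomb-b c = begin
      E.lincomb c b
        ≈⟨ E.lincomb-++ c inl inr ⟩
      E.lincomb c₁ inl E.+ᴹ E.lincomb c₂ inr
        ≈⟨ E.+ᴹ-cong {E.lincomb c₁ inl} {_} {E.lincomb c₂ inr} (lincomb-× c₁ inl) (lincomb-× c₂ inr) ⟩
      (E₁.lincomb c₁ E₁.basis E₁.+ᴹ E₁.lincomb c₂ (λ _ → E₁.0ᴹ) ,
       E₂.lincomb c₁ (λ _ → E₂.0ᴹ) E₂.+ᴹ E₂.lincomb c₂ E₂.basis)
        ≈⟨ E₁.≈ᴹ-trans (E₁.+ᴹ-congˡ (lincomb-0₁ c₂)) (E₁.+ᴹ-identityʳ _)
         , E₂.≈ᴹ-trans (E₂.+ᴹ-congʳ (lincomb-0₂ c₁)) (E₂.+ᴹ-identityˡ _) ⟩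
      (E₁.lincomb c₁ E₁.basis , E₂.lincomb c₂ E₂.basis) ∎
      where
      open SetoidReasoning E.≈ᴹ-setoid
      c₁ : Vector F.Carrier n₁
      c₁ = c ∘ (_↑ˡ n₂)
      c₂ : Vector F.Carrier n₂
      c₂ = c ∘ (n₁ ↑ʳ_)

    independent : ∀ c →
      (E₁.lincomb (c ∘ (_↑ˡ n₂)) E₁.basis , E₂.lincomb (c ∘ (n₁ ↑ʳ_)) E₂.basis) E.≈ᴹ E.0ᴹ →
      ∀ s → c (join n₁ n₂ s) ≈ 0#
    independent c (p , q) (inj₁ i) = E₁.basis-independent _ p i
    independent c (p , q) (inj₂ i) = E₂.basis-independent _ q i

    spans : ∀ {x y} → E₁.InSpan E₁.basis x → E₂.InSpan E₂.basis y → E.InSpan b (x , y)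
    spans (c , p) (d , q) = c Vector.++ d , E.≈ᴹ-trans (lincomb-b (c Vector.++ d))
      ( E₁.≈ᴹ-trans (E₁.lincomb-cong (λ i → F.reflexive (lookup-++ˡ c d i)) (λ _ → E₁.≈ᴹ-refl)) p
      , E₂.≈ᴹ-trans (E₂.lincomb-cong (λ i → F.reflexive (lookup-++ʳ c d i)) (λ _ → E₂.≈ᴹ-refl)) q)

  -- Membership is decidable, as every subset of a finite set is classically.
  record Subspace (E : VectorSpace F) : Set₁ where
    open VectorSpace E
    field
      Member   : Pred Carrierᴹ 0ℓ
      member?  : Decidable₁ Member
      respects : Member Respects _≈ᴹ_
      0-closed : Member 0ᴹ
      +-closed : ∀ {x y} → Member x → Member y → Member (x +ᴹ y)
      *-closed : ∀ a {x} → Member x → Member (a *ₗ x)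

  module _ {E : VectorSpace F} where
    open VectorSpace E

    infix 4 _∈_ _⊆_ _⊆?_

    _∈_ : Carrierᴹ → Subspace E → Set
    x ∈ V = Subspace.Member V x

    _⊆_ : Subspace E → Subspace E → Set
    V ⊆ W = ∀ x → x ∈ V → x ∈ W

    _⊆?_ : Decidable _⊆_
    V ⊆? W = ∀?
      (λ x≈y f y∈V → W.respects x≈y (f (V.respects (≈ᴹ-sym x≈y) y∈V)))
      (λ x → V.member? x →-dec W.member? x)
      where
      module V = Subspace V
      module W = Subspace W

    span : ∀ {k} → Vector Carrierᴹ k → Subspace E
    span v = record
      { Member   = InSpan v
      ; member?  = InSpan? v
      ; respects = InSpan-resp
      ; 0-closed = InSpan-0
      ; +-closed = InSpan-+
      ; *-closed = InSpan-*
      }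

    infixl 7 _∩_
    infixl 6 _∔_

    _∩_ : Subspace E → Subspace E → Subspace E
    V ∩ W = record
      { Member   = λ x → x ∈ V × x ∈ W
      ; member?  = λ x → V.member? x ×-dec W.member? x
      ; respects = λ x≈y (p , q) → V.respects x≈y p , W.respects x≈y q
      ; 0-closed = V.0-closed , W.0-closed
      ; +-closed = λ (p , q) (r , s) → V.+-closed p r , W.+-closed q s
      ; *-closed = λ a (p , q) → V.*-closed a p , W.*-closed a q
      }
      where
      module V = Subspace V
      module W = Subspace W

    _∔_ : Subspace E → Subspace E → Subspace E
    V ∔ W = record
      { Member   = λ x → ∃ λ v → ∃ λ w → v ∈ V × w ∈ W × v +ᴹ w ≈ᴹ x
      ; member?  = λ x → ∃?
          (λ v≈v′ (w , p , q , e) →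
            w , V.respects v≈v′ p , q , ≈ᴹ-trans (+ᴹ-congʳ (≈ᴹ-sym v≈v′)) e)
          (λ v → ∃?
            (λ w≈w′ (p , q , e) →
              p , W.respects w≈w′ q , ≈ᴹ-trans (+ᴹ-congˡ (≈ᴹ-sym w≈w′)) e)
            (λ w → V.member? v ×-dec W.member? w ×-dec (v +ᴹ w) ≈ᴹ? x))
      ; respects = λ x≈y (v , w , p , q , e) → v , w , p , q , ≈ᴹ-trans e x≈y
      ; 0-closed = 0ᴹ , 0ᴹ , V.0-closed , W.0-closed , +ᴹ-identityˡ 0ᴹ
      ; +-closed = λ (v , w , p , q , e) (v′ , w′ , p′ , q′ , e′) →
          v +ᴹ v′ , w +ᴹ w′ , V.+-closed p p′ , W.+-closed q q′ ,
          ≈ᴹ-trans (interchange v v′ w w′) (+ᴹ-cong e e′)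
      ; *-closed = λ a (v , w , p , q , e) →
          a *ₗ v , a *ₗ w , V.*-closed a p , W.*-closed a q ,
          ≈ᴹ-trans (≈ᴹ-sym (*ₗ-distribˡ a v w)) (*ₗ-congˡ e)
      }
      where
      module V = Subspace V
      module W = Subspace W
      open CommutativeSemigroupProperties
        (CommutativeMonoid.commutativeSemigroup +ᴹ-commutativeMonoid) using (interchange)

    record Basis (V : Subspace E) : Set where
      field
        {cardinality} : ℕ
        vector        : Vector Carrierᴹ cardinality
        inside        : ∀ i → vector i ∈ V
        independent   : LinearlyIndependent vector
        spanning      : ∀ x → x ∈ V → InSpan vector x

    -- Keep each element of V that is not in the span of those kept so far.
    chooseBasis : (V : Subspace E) → Basis V
    chooseBasis V = record
      { vector      = proj₁ (proj₂ chosen)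
      ; inside      = proj₁ (proj₂ (proj₂ chosen))
      ; independent = proj₁ (proj₂ (proj₂ (proj₂ chosen)))
      ; spanning    = λ x x∈V → let (i , e) = element-surjective x in
          InSpan-resp e (tabulate⁻ (proj₂ (proj₂ (proj₂ (proj₂ chosen)))) i
            (V.respects (≈ᴹ-sym e) x∈V))
      }
      where
      module V = Subspace V

      choose : ∀ xs → Σ ℕ λ k → Σ (Vector Carrierᴹ k) λ v →
        (∀ i → v i ∈ V) × LinearlyIndependent v × All (λ x → x ∈ V → InSpan v x) xs
      choose []       = 0 , (λ ()) , (λ ()) , (λ _ _ ()) , []
      choose (x ∷ xs) with choose xs
      ... | k , v , v∈V , indep , spans with V.member? x | InSpan? v x
      ... | no  x∉V | _         = k , v , v∈V , indep , (λ x∈V → contradiction x∈V x∉V) ∷ spans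
      ... | yes _   | yes x∈v   = k , v , v∈V , indep , (λ _ → x∈v) ∷ spans
      ... | yes x∈V | no  x∉v   =
        suc k , x Vector.∷ v
        , (λ where zero → x∈V ; (suc i) → v∈V i)
        , independent-∷ indep x∉v
        , (λ _ → InSpan-head) ∷ All.map (λ f p → InSpan-∷ (f p)) spans

      chosen = choose (tabulate element)

    dim : Subspace E → ℕ
    dim V = Basis.cardinality (chooseBasis V)

    -- Each subspace is spanned by a family of `size` vectors (its own elements,
    -- padded with 0), so spans of all such families give all subspaces of E.
    family : Fin (size ^ size) → Vector Carrierᴹ size
    family i j = element (finToFun {size} {size} i j)

    subspaces : List (Subspace E)
    subspaces = tabulate (λ i → span (family i))

    subspaces-complete : ∀ V → ∃ λ W → W ∈ˡ subspaces × V ⊆ W × W ⊆ V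
    subspaces-complete V = span (family i₀) , ∈-tabulate⁺ {f = λ i → span (family i)} i₀ , V⊆W , W⊆V
      where
      module V = Subspace V

      code : Fin size → Fin size
      code i with V.member? (element i)
      ... | yes _ = i
      ... | no  _ = proj₁ (element-surjective 0ᴹ)

      i₀ : Fin (size ^ size)
      i₀ = funToFin code

      code∈V : ∀ i → element (code i) ∈ V
      code∈V i with V.member? (element i)
      ... | yes p = p
      ... | no  _ = V.respects (≈ᴹ-sym (proj₂ (element-surjective 0ᴹ))) V.0-closed

      code-fix : ∀ i → element i ∈ V → code i ≡ i
      code-fix i p with V.member? (element i)
      ... | yes _ = ≡.refl
      ... | no ¬p = contradiction p ¬p

      lincomb∈V : ∀ {k} c (v : Vector Carrierᴹ k) → (∀ i → v i ∈ V) → lincomb c v ∈ V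
      lincomb∈V {zero}  c v v∈V = V.0-closed
      lincomb∈V {suc k} c v v∈V =
        V.+-closed (V.*-closed (c zero) (v∈V zero)) (lincomb∈V (c ∘ suc) (v ∘ suc) (v∈V ∘ suc))

      W⊆V : span (family i₀) ⊆ V
      W⊆V x (c , e) = V.respects e (lincomb∈V c (family i₀) λ i →
        ≡.subst (λ j → element j ∈ V) (≡.sym (finToFun-funToFin code i)) (code∈V i))

      V⊆W : V ⊆ span (family i₀)
      V⊆W x x∈V with element-surjective x
      ... | i , e = InSpan-resp
        (≈ᴹ-trans (≈ᴹ-reflexive (≡.cong element
          (≡.trans (finToFun-funToFin code i) (code-fix i (V.respects (≈ᴹ-sym e) x∈V))))) e)
        (InSpan-member (family i₀) i)

    -- min { f X | X ≤ V }.  The first argument of the library's `min` is one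
    -- more candidate (it makes the list non-empty); here it is f V itself.
    min-over-subspaces : (Subspace E → ℤ) → Subspace E → ℤ
    min-over-subspaces f V = min (f V) (map f (filter (_⊆? V) subspaces))

  whole : (E : VectorSpace F) → Subspace E
  whole E = record
    { Member   = λ _ → ⊤
    ; member?  = λ _ → yes tt
    ; respects = λ _ _ → tt
    ; 0-closed = tt
    ; +-closed = λ _ _ → tt
    ; *-closed = λ _ _ → tt
    }

  IsLinear : (E E′ : VectorSpace F) → (VectorSpace.Carrierᴹ E → VectorSpace.Carrierᴹ E′) → Set
  IsLinear E E′ = ModuleMorphisms.IsModuleHomomorphism
    (VectorSpace.rawModule E) (VectorSpace.rawModule E′)

  image : ∀ {E E′ : VectorSpace F} {f} → IsLinear E E′ f → Subspace E → Subspace E′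
  image {E} {E′} {f} f-linear V = record
    { Member   = λ y → ∃ λ x → x ∈ V × f x E′.≈ᴹ y
    ; member?  = λ y → E.∃?
        (λ x≈x′ (p , e) → V.respects x≈x′ p , E′.≈ᴹ-trans (f.⟦⟧-cong (E.≈ᴹ-sym x≈x′)) e)
        (λ x → V.member? x ×-dec f x E′.≈ᴹ? y)
    ; respects = λ y≈y′ (x , p , e) → x , p , E′.≈ᴹ-trans e y≈y′
    ; 0-closed = E.0ᴹ , V.0-closed , f.0ᴹ-homo
    ; +-closed = λ (x , p , e) (x′ , p′ , e′) →
        x E.+ᴹ x′ , V.+-closed p p′ , E′.≈ᴹ-trans (f.+ᴹ-homo x x′) (E′.+ᴹ-cong e e′)
    ; *-closed = λ a (x , p , e) →
        a E.*ₗ x , V.*-closed a p , E′.≈ᴹ-trans (f.*ₗ-homo a x) (E′.*ₗ-congˡ e)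
    }
    where
    module E = VectorSpace E
    module E′ = VectorSpace E′
    module V = Subspace V
    module f = ModuleMorphisms.IsModuleHomomorphism f-linear

  module _ {E₁ E₂ : VectorSpace F} where
    private
      module E₁ = VectorSpace E₁
      module E₂ = VectorSpace E₂

    proj₁-linear : IsLinear (E₁ ⊕ⱽ E₂) E₁ proj₁
    proj₁-linear = record { isBimoduleHomomorphism = record
      { +ᴹ-isGroupHomomorphism = record
        { isMonoidHomomorphism = record
          { isMagmaHomomorphism = record
            { isRelHomomorphism = record { cong = proj₁ }
            ; homo = λ _ _ → E₁.≈ᴹ-refl
            }
          ; ε-homo = E₁.≈ᴹ-refl
          }
        ; ⁻¹-homo = λ _ → E₁.≈ᴹ-refl
        }
      ; *ₗ-homo = λ _ _ → E₁.≈ᴹ-refl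
      ; *ᵣ-homo = λ _ _ → E₁.≈ᴹ-refl
      } }

    proj₂-linear : IsLinear (E₁ ⊕ⱽ E₂) E₂ proj₂
    proj₂-linear = record { isBimoduleHomomorphism = record
      { +ᴹ-isGroupHomomorphism = record
        { isMonoidHomomorphism = record
          { isMagmaHomomorphism = record
            { isRelHomomorphism = record { cong = proj₂ }
            ; homo = λ _ _ → E₂.≈ᴹ-refl
            }
          ; ε-homo = E₂.≈ᴹ-refl
          }
        ; ⁻¹-homo = λ _ → E₂.≈ᴹ-refl
        }
      ; *ₗ-homo = λ _ _ → E₂.≈ᴹ-refl
      ; *ᵣ-homo = λ _ _ → E₂.≈ᴹ-refl
      } }

    π₁ : Subspace (E₁ ⊕ⱽ E₂) → Subspace E₁
    π₁ = image proj₁-linear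

    π₂ : Subspace (E₁ ⊕ⱽ E₂) → Subspace E₂
    π₂ = image proj₂-linear

  Form : VectorSpace F → Set
  Form E = Carrierᴹ → Carrierᴹ → FiniteField.Carrier F
    where open VectorSpace E

  record IsNondegenerateSymmetricBilinear (E : VectorSpace F) (⟨_,_⟩ : Form E) : Set where
    open VectorSpace E
    field
      cong          : ∀ {v v′ w w′} → v ≈ᴹ v′ → w ≈ᴹ w′ → ⟨ v , w ⟩ ≈ ⟨ v′ , w′ ⟩
      +-linearˡ     : ∀ v v′ w → ⟨ v +ᴹ v′ , w ⟩ ≈ ⟨ v , w ⟩ + ⟨ v′ , w ⟩
      *-linearˡ     : ∀ a v w → ⟨ a *ₗ v , w ⟩ ≈ a * ⟨ v , w ⟩
      +-linearʳ     : ∀ v w w′ → ⟨ v , w +ᴹ w′ ⟩ ≈ ⟨ v , w ⟩ + ⟨ v , w′ ⟩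
      *-linearʳ     : ∀ a v w → ⟨ v , a *ₗ w ⟩ ≈ a * ⟨ v , w ⟩
      symmetric     : ∀ v w → ⟨ v , w ⟩ ≈ ⟨ w , v ⟩
      nondegenerate : ∀ v → (∀ w → ⟨ v , w ⟩ ≈ 0#) → v ≈ᴹ 0ᴹ

  record NondegenerateSymmetricForm (E : VectorSpace F) : Set where
    constructor mkForm
    field
      form                             : Form E
      isNondegenerateSymmetricBilinear : IsNondegenerateSymmetricBilinear E form

    open IsNondegenerateSymmetricBilinear isNondegenerateSymmetricBilinear public

  infixr 6 _⊕ᶠ_

  _⊕ᶠ_ : ∀ {E₁ E₂} → NondegenerateSymmetricForm E₁ → NondegenerateSymmetricForm E₂ → Form (E₁ ⊕ⱽ E₂)
  (B₁ ⊕ᶠ B₂) (v₁ , v₂) (w₁ , w₂) = B₁.form v₁ w₁ + B₂.form v₂ w₂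
    where
    module B₁ = NondegenerateSymmetricForm B₁
    module B₂ = NondegenerateSymmetricForm B₂

  orthogonal : ∀ {E} → NondegenerateSymmetricForm E → Subspace E → Subspace E
  orthogonal {E} B V = record
    { Member   = λ w → ∀ v → v ∈ V → ⟨ v , w ⟩ ≈ 0#
    ; member?  = λ w → ∀?
        (λ v≈v′ f v′∈V → F.trans (B.cong (≈ᴹ-sym v≈v′) ≈ᴹ-refl) (f (V.respects (≈ᴹ-sym v≈v′) v′∈V)))
        (λ v → V.member? v →-dec ⟨ v , w ⟩ ≈? 0#)
    ; respects = λ w≈w′ f v p → F.trans (B.cong ≈ᴹ-refl (≈ᴹ-sym w≈w′)) (f v p)
    ; 0-closed = λ v _ → F.trans (B.cong ≈ᴹ-refl (≈ᴹ-sym (*ₗ-zeroˡ 0ᴹ)))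
        (F.trans (B.*-linearʳ 0# v 0ᴹ) (F.zeroˡ _))
    ; +-closed = λ f g v p → F.trans (B.+-linearʳ v _ _)
        (F.trans (F.+-cong (f v p) (g v p)) (F.+-identityˡ 0#))
    ; *-closed = λ a f v p → F.trans (B.*-linearʳ a v _)
        (F.trans (F.*-congˡ (f v p)) (F.zeroʳ a))
    }
    where
    open VectorSpace E
    module F = FiniteField F
    module B = NondegenerateSymmetricForm B
    module V = Subspace V
    ⟨_,_⟩ = B.form

  -- Ranks are integers, with non-negativity an axiom of q-matroids, so that the
  -- subtractions in the dual and in the direct sum are not truncated.
  RankFunction : VectorSpace F → Set₁
  RankFunction E = Subspace E → ℤ

  record IsQMatroid (E : VectorSpace F) (ρ : RankFunction E) : Set₁ where
    field
      nonnegative : ∀ V → 0ℤ ≤ᶻ ρ V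
      bounded     : ∀ V → ρ V ≤ᶻ pos (dim V)
      monotone    : ∀ V W → V ⊆ W → ρ V ≤ᶻ ρ W
      submodular  : ∀ V W → ρ (V ∔ W) +ᶻ ρ (V ∩ W) ≤ᶻ ρ V +ᶻ ρ W

  record QMatroid (E : VectorSpace F) : Set₁ where
    field
      ρ          : RankFunction E
      isQMatroid : IsQMatroid E ρ

    open IsQMatroid isQMatroid public

  infix 9 _*[_]
  infixr 6 _⊕_

  _*[_] : ∀ {E} → RankFunction E → NondegenerateSymmetricForm E → RankFunction E
  _*[_] {E} ρ B V = pos (dim V) +ᶻ ρ (orthogonal B V) -ᶻ ρ (whole E)

  _⊕_ : ∀ {E₁ E₂} → RankFunction E₁ → RankFunction E₂ → RankFunction (E₁ ⊕ⱽ E₂)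
  (ρ₁ ⊕ ρ₂) V =
    pos (dim V) +ᶻ min-over-subspaces (λ X → ρ₁ (π₁ X) +ᶻ ρ₂ (π₂ X) -ᶻ pos (dim X)) V

module Submission where

-- Up to the constant ρ₁(E₁) + ρ₂(E₂), which is the rank of E in M₁ ⊕ M₂, both
-- sides are minima: of dim V⊥ − dim Y + ρ₁(π₁Y) + ρ₂(π₂Y) over Y ≤ V⊥, and of
-- dim π₁X + dim π₂X − dim X + ρ₁((π₁X)⊥) + ρ₂((π₂X)⊥) over X ≤ V.  Each X is
-- matched by Y = V⊥ ∩ ((π₁X)⊥ × (π₂X)⊥) and each Y by X = V ∩ ((π₁Y)⊥ × (π₂Y)⊥);
-- the values compare by modularity of dim, dim U + dim U⊥ = dim E, and
-- ρ(W) − ρ(U) ≤ dim W − dim U for U ≤ W.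

open import Defs
import Algebra.Properties.AbelianGroup as AbelianGroupProperties
import Algebra.Properties.CommutativeSemigroup as CommutativeSemigroupProperties
import Algebra.Properties.Ring as RingProperties
open import Data.Fin.Base using (Fin; zero; suc; finToFun; funToFin; combine; splitAt; join; _↑ˡ_; _↑ʳ_)
open import Data.Fin.Properties using (injective⇒≤; funToFin-finToFin; finToFun-funToFin; join-splitAt)
open import Data.Integer.Base using (0ℤ; +≤+)
  renaming (+_ to pos; _+_ to _+ᶻ_; _-_ to _-ᶻ_; _≤_ to _≤ᶻ_)
import Data.Integer.Properties as ℤ
open import Data.Integer.Tactic.RingSolver using (solve)
open import Data.List.Base using ([]; _∷_; map; filter; tabulate)
open import Data.List.Extrema ℤ.≤-totalOrder using (argmin-sel; min≤xs)
open import Data.List.Membership.Propositional.Properties using (∈-map∘filter⁻; ∈-map∘filter⁺)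
open import Data.List.Relation.Unary.All as All using (All)
open import Data.List.Relation.Unary.All.Properties using (tabulate⁻)
open import Data.Nat.Base using (ℕ; zero; suc; s≤s; z≤n; _^_; _<_) renaming (_+_ to _+ℕ_; _≤_ to _≤ℕ_)
import Data.Nat.Properties as ℕ
open import Data.Product.Base using (Σ; ∃; _×_; _,_; proj₁; proj₂)
open import Data.Sum.Base using (inj₁; inj₂)
open import Data.Sum.Properties using ([,]-map)
open import Data.Unit.Base using (tt)
open import Data.Vec.Functional as Vector using (Vector)
open import Data.Vec.Functional.Properties using (lookup-++ˡ; lookup-++ʳ)
open import Function.Base using (_∘_; id)
open import Function.Bundles using (Inverse)
open import Relation.Binary.PropositionalEquality as ≡ using (_≡_; _≢_)
open import Relation.Binary.PropositionalEquality.Core using (_≗_)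
import Relation.Binary.Reasoning.Setoid as SetoidReasoning
open import Relation.Nullary using (yes; no; contradiction)
open import Relation.Nullary.Decidable using (_×-dec_)

-- Functions between finite sets and concatenation of vectors.

funToFin-cong : ∀ {m n} {f g : Fin m → Fin n} → f ≗ g → funToFin f ≡ funToFin g
funToFin-cong {zero}  f≗g = ≡.refl
funToFin-cong {suc m} f≗g = ≡.cong₂ combine (f≗g zero) (funToFin-cong (f≗g ∘ suc))

distinct⇒1< : ∀ {n} (i j : Fin n) → i ≢ j → 1 < n
distinct⇒1< {suc zero}    zero zero i≢j = contradiction ≡.refl i≢j
distinct⇒1< {suc (suc n)} _    _    _   = s≤s (s≤s z≤n)

∷-++ : ∀ {A : Set} {j k} (x : A) (v : Vector A j) (w : Vector A k) →
  (x Vector.∷ (v Vector.++ w)) ≗ ((x Vector.∷ v) Vector.++ w)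
∷-++         x v w zero    = ≡.refl
∷-++ {j = j} x v w (suc i) = ≡.sym ([,]-map (splitAt j i))

-- Integer inequalities between ranks and dimensions.

-- Each inequality over ℤ below is a sum of known ones, up to a ring identity
-- between the differences of the two sides.
≤-by-difference : ∀ {a b c d} → a ≤ᶻ b → d -ᶻ c ≡ b -ᶻ a → c ≤ᶻ d
≤-by-difference a≤b eq = ℤ.0≤i-j⇒j≤i (≡.subst (0ℤ ≤ᶻ_) (≡.sym eq) (ℤ.i≤j⇒0≤j-i a≤b))

-- Here `w`, `v` are the ranks and `e`, `d` the dimensions of two spaces V ≤ W, and `k` is the
-- number of vectors added to a basis of V.
rank-increase-bound : ∀ w v k d e → w ≤ᶻ k +ᶻ v → k +ᶻ d ≤ᶻ e → w +ᶻ d ≤ᶻ v +ᶻ e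
rank-increase-bound w v k d e h₁ h₂ =
  ≤-by-difference (ℤ.+-mono-≤ h₁ h₂) (solve (w ∷ v ∷ k ∷ d ∷ e ∷ []))

-- Here rᵢ = ρᵢ(Eᵢ), tᵢ = ρᵢ(πᵢX), pᵢ = dim πᵢX, eᵢ = dim Eᵢ, and `x`, `e` are the dimensions of X
-- and E.
full-rank-bound : ∀ r₁ r₂ e t₁ t₂ x p₁ p₂ e₁ e₂ →
  r₁ +ᶻ p₁ ≤ᶻ t₁ +ᶻ e₁ → r₂ +ᶻ p₂ ≤ᶻ t₂ +ᶻ e₂ → e₁ +ᶻ e₂ ≤ᶻ e → x ≤ᶻ p₁ +ᶻ p₂ →
  r₁ +ᶻ r₂ ≤ᶻ e +ᶻ (t₁ +ᶻ t₂ -ᶻ x)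
full-rank-bound r₁ r₂ e t₁ t₂ x p₁ p₂ e₁ e₂ h₁ h₂ h₃ h₄ =
  ≤-by-difference (ℤ.+-mono-≤ (ℤ.+-mono-≤ h₁ h₂) (ℤ.+-mono-≤ h₃ h₄))
    (solve (r₁ ∷ r₂ ∷ e ∷ t₁ ∷ t₂ ∷ x ∷ p₁ ∷ p₂ ∷ e₁ ∷ e₂ ∷ []))

-- In the next two lemmas v, v⊥, x, x⊥, y, y⊥ are the dimensions of V, V⊥, X, X⊥, Y, Y⊥, and
-- dᵢ = dim πᵢX, qᵢ = dim (πᵢX)⊥, sᵢ = ρᵢ((πᵢX)⊥), pᵢ = dim πᵢY, oᵢ = dim (πᵢY)⊥, tᵢ = ρᵢ(πᵢY),
-- eᵢ = dim Eᵢ, rᵢ = ρᵢ(Eᵢ).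
primal-bound : ∀ v⊥ y x x⊥ e e₁ e₂ d₁ d₂ q₁ q₂ s₁ s₂ t₁ t₂ r₁ r₂ →
  t₁ ≤ᶻ s₁ → t₂ ≤ᶻ s₂ → v⊥ +ᶻ (q₁ +ᶻ q₂) ≤ᶻ x⊥ +ᶻ y → x +ᶻ x⊥ ≤ᶻ e →
  e ≤ᶻ e₁ +ᶻ e₂ → e₁ ≤ᶻ d₁ +ᶻ q₁ → e₂ ≤ᶻ d₂ +ᶻ q₂ →
  v⊥ +ᶻ (t₁ +ᶻ t₂ -ᶻ y) ≤ᶻ
  ((d₁ +ᶻ s₁ -ᶻ r₁) +ᶻ (d₂ +ᶻ s₂ -ᶻ r₂) -ᶻ x) +ᶻ (r₁ +ᶻ r₂)
primal-bound v⊥ y x x⊥ e e₁ e₂ d₁ d₂ q₁ q₂ s₁ s₂ t₁ t₂ r₁ r₂ h₁ h₂ h₃ h₄ h₅ h₆ h₇ = ≤-by-difference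
  (ℤ.+-mono-≤ h₁ (ℤ.+-mono-≤ h₂ (ℤ.+-mono-≤ h₃ (ℤ.+-mono-≤ h₄ (ℤ.+-mono-≤ h₅ (ℤ.+-mono-≤ h₆ h₇))))))
  (solve (v⊥ ∷ y ∷ x ∷ x⊥ ∷ e ∷ e₁ ∷ e₂ ∷ d₁ ∷ d₂ ∷ q₁ ∷ q₂ ∷ s₁ ∷ s₂ ∷ t₁ ∷ t₂ ∷ r₁ ∷ r₂ ∷ []))

dual-bound : ∀ v v⊥ y y⊥ x d₁ d₂ q₁ q₂ p₁ p₂ o₁ o₂ s₁ s₂ t₁ t₂ r₁ r₂ →
  s₁ +ᶻ p₁ ≤ᶻ t₁ +ᶻ q₁ → s₂ +ᶻ p₂ ≤ᶻ t₂ +ᶻ q₂ →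
  d₁ +ᶻ q₁ ≤ᶻ p₁ +ᶻ o₁ → d₂ +ᶻ q₂ ≤ᶻ p₂ +ᶻ o₂ →
  v +ᶻ (o₁ +ᶻ o₂) ≤ᶻ y⊥ +ᶻ x → y +ᶻ y⊥ ≤ᶻ v +ᶻ v⊥ →
  ((d₁ +ᶻ s₁ -ᶻ r₁) +ᶻ (d₂ +ᶻ s₂ -ᶻ r₂) -ᶻ x) +ᶻ (r₁ +ᶻ r₂) ≤ᶻ
  v⊥ +ᶻ (t₁ +ᶻ t₂ -ᶻ y)
dual-bound v v⊥ y y⊥ x d₁ d₂ q₁ q₂ p₁ p₂ o₁ o₂ s₁ s₂ t₁ t₂ r₁ r₂ h₁ h₂ h₃ h₄ h₅ h₆ = ≤-by-difference
  (ℤ.+-mono-≤ h₁ (ℤ.+-mono-≤ h₂ (ℤ.+-mono-≤ h₃ (ℤ.+-mono-≤ h₄ (ℤ.+-mono-≤ h₅ h₆)))))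
  (solve (v ∷ v⊥ ∷ y ∷ y⊥ ∷ x ∷ d₁ ∷ d₂ ∷ q₁ ∷ q₂ ∷ p₁ ∷ p₂ ∷ o₁ ∷ o₂ ∷ s₁ ∷ s₂ ∷ t₁ ∷ t₂ ∷ r₁ ∷ r₂ ∷ []))

+-cancel-minus : ∀ a b c → a +ᶻ (b +ᶻ c) -ᶻ c ≡ a +ᶻ b
+-cancel-minus a b c = solve (a ∷ b ∷ c ∷ [])

minus-cancel-+ : ∀ a b → a +ᶻ (b -ᶻ a) ≡ b
minus-cancel-+ a b = solve (a ∷ b ∷ [])

module _ {F : FiniteField} where
  open FiniteField F hiding (inverse)

  -- Comparing dimensions by counting coefficient vectors.

  -- The codes of `0#` and `1#` differ. This makes `order ^_` strictly monotone, so that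
  -- cardinalities determine exponents.
  1<order : 1 < order
  1<order = distinct⇒1< (to 1#) (to 0#) λ eq → 1≉0 (trans (sym (strictlyInverseʳ 1#))
      (trans (reflexive (≡.cong from eq)) (strictlyInverseʳ 0#)))
    where open Inverse enumeration

  -- An injection F^k → F^m gives q^k ≤ q^m.
  injection⇒≤ : ∀ {k m} (g : Vector Carrier k → Vector Carrier m) →
    (∀ c d → (∀ j → g c j ≈ g d j) → ∀ i → c i ≈ d i) → k ≤ℕ m
  injection⇒≤ {k} {m} g g-injective = ℕ.≮⇒≥ λ m<k →
    ℕ.≤⇒≯ (injective⇒≤ h-injective) (ℕ.^-monoʳ-< order 1<order m<k)
    where
    open Inverse enumeration using (to; from; to-cong; strictlyInverseˡ; strictlyInverseʳ)

    to-injective : ∀ {x y} → to x ≡ to y → x ≈ y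
    to-injective {x} {y} eq = trans (sym (strictlyInverseʳ x))
      (trans (reflexive (≡.cong from eq)) (strictlyInverseʳ y))

    h : Fin (order ^ k) → Fin (order ^ m)
    h i = funToFin (to ∘ g (coefficients i))

    h-injective : ∀ {i i′} → h i ≡ h i′ → i ≡ i′
    h-injective {i} {i′} eq =
      ≡.trans (≡.sym (funToFin-finToFin {k} {order} i))
        (≡.trans (funToFin-cong same) (funToFin-finToFin {k} {order} i′))
      where
      g≈ : ∀ j → g (coefficients i) j ≈ g (coefficients i′) j
      g≈ j = to-injective (≡.trans (≡.sym (finToFun-funToFin (to ∘ g (coefficients i)) j))
        (≡.trans (≡.cong (λ n → finToFun n j) eq) (finToFun-funToFin (to ∘ g (coefficients i′)) j)))

      same : finToFun {order} {k} i ≗ finToFun i′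
      same j = ≡.trans (≡.sym (strictlyInverseˡ _))
        (≡.trans (to-cong (g-injective _ _ g≈ j)) (strictlyInverseˡ _))

  -- Independence, spans and dimension in one vector space.

  module _ {E : VectorSpace F} where
    open VectorSpace E
    open AbelianGroupProperties +ᴹ-abelianGroup using (x∙y⁻¹≈ε⇒x≈y; x≈y⇒x∙y⁻¹≈ε; inverseˡ-unique; xyx⁻¹≈y)
    open AbelianGroupProperties +-abelianGroup using ()
      renaming (x∙y⁻¹≈ε⇒x≈y to x-y≈0⇒x≈y)

    -ᴹ≈-1* : ∀ x → -ᴹ x ≈ᴹ (- 1#) *ₗ x
    -ᴹ≈-1* x = ≈ᴹ-sym (inverseˡ-unique _ _ (-1*x≈-x x))

    lincomb-neg : ∀ {k} (c : Vector Carrier k) v → lincomb (λ i → - c i) v ≈ᴹ -ᴹ lincomb c v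
    lincomb-neg c v = begin
      lincomb (λ i → - c i) v        ≈⟨ lincomb-cong (λ i → sym (RingProperties.-1*x≈-x ring (c i))) (λ _ → ≈ᴹ-refl) ⟩
      lincomb (λ i → (- 1#) * c i) v ≈⟨ lincomb-* (- 1#) c v ⟩
      (- 1#) *ₗ lincomb c v          ≈⟨ -ᴹ≈-1* _ ⟨
      -ᴹ lincomb c v                 ∎
      where open SetoidReasoning ≈ᴹ-setoid

    lincomb-- : ∀ {k} (c d : Vector Carrier k) v →
      lincomb (λ i → c i - d i) v ≈ᴹ lincomb c v +ᴹ -ᴹ lincomb d v
    lincomb-- c d v = ≈ᴹ-trans (lincomb-+ c (λ i → - d i) v) (+ᴹ-congˡ (lincomb-neg d v))

    lincomb-injective : ∀ {k} {v : Vector Carrierᴹ k} → LinearlyIndependent v →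
      ∀ c d → lincomb c v ≈ᴹ lincomb d v → ∀ i → c i ≈ d i
    lincomb-injective {v = v} indep c d eq i = x-y≈0⇒x≈y (c i) (d i)
      (indep (λ i → c i - d i) (≈ᴹ-trans (lincomb-- c d v) (x≈y⇒x∙y⁻¹≈ε eq)) i)

    lincomb-++-++ : ∀ {j k} (c : Vector Carrier j) (d : Vector Carrier k) v w →
      lincomb (c Vector.++ d) (v Vector.++ w) ≈ᴹ lincomb c v +ᴹ lincomb d w
    lincomb-++-++ c d v w = ≈ᴹ-trans (lincomb-++ (c Vector.++ d) v w) (+ᴹ-cong
      (lincomb-cong (λ i → reflexive (lookup-++ˡ c d i)) (λ _ → ≈ᴹ-refl))
      (lincomb-cong (λ i → reflexive (lookup-++ʳ c d i)) (λ _ → ≈ᴹ-refl)))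

    module _ (V : Subspace E) where
      private module V = Subspace V

      lincomb-closed : ∀ {k} c (v : Vector Carrierᴹ k) → (∀ i → v i ∈ V) → lincomb c v ∈ V
      lincomb-closed {zero}  c v v∈V = V.0-closed
      lincomb-closed {suc k} c v v∈V =
        V.+-closed (V.*-closed (c zero) (v∈V zero)) (lincomb-closed (c ∘ suc) (v ∘ suc) (v∈V ∘ suc))

      neg-closed : ∀ {x} → x ∈ V → (-ᴹ x) ∈ V
      neg-closed {x} x∈V = V.respects (≈ᴹ-sym (-ᴹ≈-1* x)) (V.*-closed (- 1#) x∈V)

    InSpan⇒∈ : ∀ (V : Subspace E) {k} {v : Vector Carrierᴹ k} → (∀ i → v i ∈ V) → ∀ {x} → InSpan v x → x ∈ V
    InSpan⇒∈ V {v = v} v∈V (c , e) = Subspace.respects V e (lincomb-closed V c v v∈V)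

    InSpan-lincomb : ∀ {j k} {v : Vector Carrierᴹ j} {w : Vector Carrierᴹ k} → (∀ i → InSpan w (v i)) →
      ∀ {x} → InSpan v x → InSpan w x
    InSpan-lincomb {w = w} = InSpan⇒∈ (span w)

    -- Steinitz: coordinates with respect to w embed the combinations of v.
    independent⇒≤ : ∀ {k m} {v : Vector Carrierᴹ k} {w : Vector Carrierᴹ m} →
      LinearlyIndependent v → (∀ i → InSpan w (v i)) → k ≤ℕ m
    independent⇒≤ {k} {m} {v} {w} indep v∈w = injection⇒≤ (λ c → proj₁ (coords c)) λ c d eq →
      lincomb-injective indep c d (begin
        lincomb c v                   ≈⟨ proj₂ (coords c) ⟨
        lincomb (proj₁ (coords c)) w  ≈⟨ lincomb-cong eq (λ _ → ≈ᴹ-refl) ⟩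
        lincomb (proj₁ (coords d)) w  ≈⟨ proj₂ (coords d) ⟩
        lincomb d v                   ∎)
      where
      open SetoidReasoning ≈ᴹ-setoid
      coords : ∀ c → InSpan w (lincomb c v)
      coords c = InSpan-lincomb v∈w (c , ≈ᴹ-refl)

    -- `dim` counts the vectors of one greedily chosen basis; by Steinitz that count bounds every
    -- independent family in V, whatever the choice was.
    independent⇒≤dim : ∀ (V : Subspace E) {k} {v : Vector Carrierᴹ k} →
      LinearlyIndependent v → (∀ i → v i ∈ V) → k ≤ℕ dim V
    independent⇒≤dim V indep v∈V =
      independent⇒≤ indep (λ i → Basis.spanning (chooseBasis V) _ (v∈V i))

    spanning⇒dim≤ : ∀ (V : Subspace E) {k} {v : Vector Carrierᴹ k} →
      (∀ x → x ∈ V → InSpan v x) → dim V ≤ℕ k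
    spanning⇒dim≤ V spans = independent⇒≤ independent (λ i → spans _ (inside i))
      where open Basis (chooseBasis V)

    dim-mono : ∀ {V W : Subspace E} → V ⊆ W → dim V ≤ℕ dim W
    dim-mono {V} {W} V⊆W = independent⇒≤dim W independent (λ i → V⊆W _ (inside i))
      where open Basis (chooseBasis V)

    -- The family `b` need not lie in V: `vector` represents a basis of (V + span b) / span b.
    record Extension {n} (b : Vector Carrierᴹ n) (V : Subspace E) : Set where
      field
        {extra}     : ℕ
        vector      : Vector Carrierᴹ extra
        inside      : ∀ i → vector i ∈ V
        independent : LinearlyIndependent (vector Vector.++ b)
        spanning    : ∀ x → x ∈ V → InSpan (vector Vector.++ b) x

      split : ∀ {x} → InSpan (vector Vector.++ b) x →
        ∃ λ c → ∃ λ d → lincomb c vector +ᴹ lincomb d b ≈ᴹ x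
      split (c , e) = c ∘ (_↑ˡ n) , c ∘ (extra ↑ʳ_) , ≈ᴹ-trans (≈ᴹ-sym (lincomb-++ c vector b)) e

      -- If the combination of `vector` by `c` equals that of `b` by `d`, then `c` followed by `- d`
      -- is a relation of the joint family.
      independent-modulo : ∀ c → InSpan b (lincomb c vector) → ∀ i → c i ≈ 0#
      independent-modulo c (d , e) i = trans (reflexive (≡.sym (lookup-++ˡ c (λ i → - d i) i)))
        (independent (c Vector.++ (λ i → - d i)) (begin
          lincomb (c Vector.++ (λ i → - d i)) (vector Vector.++ b)
            ≈⟨ lincomb-++-++ c (λ i → - d i) vector b ⟩
          lincomb c vector +ᴹ lincomb (λ i → - d i) b
            ≈⟨ +ᴹ-congˡ (lincomb-neg d b) ⟩
          lincomb c vector +ᴹ -ᴹ lincomb d b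
            ≈⟨ x≈y⇒x∙y⁻¹≈ε (≈ᴹ-sym e) ⟩
          0ᴹ ∎) (i ↑ˡ n))
        where open SetoidReasoning ≈ᴹ-setoid

    -- The greedy choice of `chooseBasis`, started from `b` instead of from the empty family.
    extend : ∀ {n} {b : Vector Carrierᴹ n} → LinearlyIndependent b → ∀ V → Extension b V
    extend {n} {b} b-independent V = record
      { vector      = proj₁ (proj₂ chosen)
      ; inside      = proj₁ (proj₂ (proj₂ chosen))
      ; independent = proj₁ (proj₂ (proj₂ (proj₂ chosen)))
      ; spanning    = λ x x∈V → let (i , e) = element-surjective x in
          InSpan-resp e (tabulate⁻ (proj₂ (proj₂ (proj₂ (proj₂ chosen)))) i
            (V.respects (≈ᴹ-sym e) x∈V))
      }
      where
      module V = Subspace V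

      choose : ∀ xs → Σ ℕ λ k → Σ (Vector Carrierᴹ k) λ v →
        (∀ i → v i ∈ V) × LinearlyIndependent (v Vector.++ b) ×
        All (λ x → x ∈ V → InSpan (v Vector.++ b) x) xs
      choose []       = 0 , (λ ()) , (λ ()) , b-independent , All.[]
      choose (x ∷ xs) with choose xs
      ... | k , v , v∈V , indep , spans with V.member? x | InSpan? (v Vector.++ b) x
      ... | no  x∉V | _         = k , v , v∈V , indep , (λ x∈V → contradiction x∈V x∉V) All.∷ spans
      ... | yes _   | yes x∈v   = k , v , v∈V , indep , (λ _ → x∈v) All.∷ spans
      ... | yes x∈V | no  x∉v   =
        suc k , x Vector.∷ v
        , (λ where zero → x∈V ; (suc i) → v∈V i)
        , (λ c eq → independent-∷ indep x∉v c (≈ᴹ-trans (reindex c) eq))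
        , (λ _ → shift InSpan-head) All.∷ All.map (λ f p → shift (InSpan-∷ (f p))) spans
        where
        -- The two concatenations agree at every index but not by computation, because `++` goes
        -- through `splitAt`.
        reindex : ∀ c → lincomb c (x Vector.∷ (v Vector.++ b)) ≈ᴹ lincomb c ((x Vector.∷ v) Vector.++ b)
        reindex c = lincomb-cong {c = c} (λ _ → refl) (λ i → ≈ᴹ-reflexive (∷-++ x v b i))

        shift : ∀ {y} → InSpan (x Vector.∷ (v Vector.++ b)) y → InSpan ((x Vector.∷ v) Vector.++ b) y
        shift (c , e) = c , ≈ᴹ-trans (≈ᴹ-sym (reindex c)) e

      chosen = choose (tabulate element)

    ++-inside : ∀ (V : Subspace E) {j k} (v : Vector Carrierᴹ j) (w : Vector Carrierᴹ k) →
      (∀ i → v i ∈ V) → (∀ i → w i ∈ V) → ∀ i → (v Vector.++ w) i ∈ V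
    ++-inside V {j} v w v∈V w∈V i with splitAt j i
    ... | inj₁ i₁ = v∈V i₁
    ... | inj₂ i₂ = w∈V i₂

    extension-dim≤ : ∀ {V W : Subspace E} → V ⊆ W →
      (X : Extension (Basis.vector (chooseBasis V)) W) → Extension.extra X +ℕ dim V ≤ℕ dim W
    extension-dim≤ {V} {W} V⊆W X = independent⇒≤dim W X.independent
      (++-inside W X.vector V.vector X.inside (λ i → V⊆W _ (V.inside i)))
      where
      module V = Basis (chooseBasis V)
      module X = Extension X

    ⊆-∔ʳ : ∀ (V W : Subspace E) → W ⊆ V ∔ W
    ⊆-∔ʳ V W x x∈W = 0ᴹ , x , Subspace.0-closed V , x∈W , +ᴹ-identityˡ x

    ⊆-∔ˡ : ∀ (V W : Subspace E) → V ⊆ V ∔ W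
    ⊆-∔ˡ V W x x∈V = x , 0ᴹ , x∈V , Subspace.0-closed W , +ᴹ-identityʳ x

    ∔-least : ∀ {U} (V W : Subspace E) → V ⊆ U → W ⊆ U → V ∔ W ⊆ U
    ∔-least {U} V W V⊆U W⊆U x (v , w , p , q , e) =
      Subspace.respects U e (Subspace.+-closed U (V⊆U v p) (W⊆U w q))

    -- Extend a basis of W by vectors of V. The added vectors span V together with a basis of V ∩ W,
    -- and with the basis of W they are independent in V + W.
    dim-modular : ∀ (V W : Subspace E) → dim V +ℕ dim W ≤ℕ dim (V ∔ W) +ℕ dim (V ∩ W)
    dim-modular V W = begin
      dim V +ℕ dim W                          ≤⟨ ℕ.+-monoˡ-≤ (dim W) (spanning⇒dim≤ V V-spanned) ⟩
      (X.extra +ℕ dim (V ∩ W)) +ℕ dim W       ≡⟨ ℕ.+-assoc X.extra _ _ ⟩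
      X.extra +ℕ (dim (V ∩ W) +ℕ dim W)       ≡⟨ ≡.cong (X.extra +ℕ_) (ℕ.+-comm (dim (V ∩ W)) (dim W)) ⟩
      X.extra +ℕ (dim W +ℕ dim (V ∩ W))       ≡⟨ ℕ.+-assoc X.extra _ _ ⟨
      (X.extra +ℕ dim W) +ℕ dim (V ∩ W)       ≤⟨ ℕ.+-monoˡ-≤ _ (independent⇒≤dim (V ∔ W) X.independent
        (++-inside (V ∔ W) X.vector W.vector
          (λ i → ⊆-∔ˡ V W _ (X.inside i)) (λ i → ⊆-∔ʳ V W _ (W.inside i)))) ⟩
      dim (V ∔ W) +ℕ dim (V ∩ W)              ∎
      where
      open ℕ.≤-Reasoning
      module W = Basis (chooseBasis W)
      module I = Basis (chooseBasis (V ∩ W))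
      X = extend W.independent V
      module X = Extension X

      -- The W-part of the decomposition of an x ∈ V lies in V ∩ W.
      V-spanned : ∀ x → x ∈ V → InSpan (X.vector Vector.++ I.vector) x
      V-spanned x x∈V with X.split (X.spanning x x∈V)
      ... | c , d , e with I.spanning (lincomb d W.vector)
              ( Subspace.respects V y≈ (Subspace.+-closed V x∈V (neg-closed V (lincomb-closed V c X.vector X.inside)))
              , lincomb-closed W d W.vector W.inside)
        where
        y≈ : x +ᴹ -ᴹ lincomb c X.vector ≈ᴹ lincomb d W.vector
        y≈ = ≈ᴹ-trans (+ᴹ-congʳ (≈ᴹ-sym e)) (xyx⁻¹≈y (lincomb c X.vector) (lincomb d W.vector))
      ... | d′ , e′ = c Vector.++ d′ ,
        ≈ᴹ-trans (lincomb-++-++ c d′ X.vector I.vector) (≈ᴹ-trans (+ᴹ-congˡ e′) e)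

  -- Orthogonal spaces and their dimensions.

  module _ {E : VectorSpace F} (B : NondegenerateSymmetricForm E) where
    open VectorSpace E
    open NondegenerateSymmetricForm B renaming (form to ⟨_,_⟩; cong to ⟨⟩-cong)

    ⟨⟩-lincomb≈0 : ∀ {k} c (v : Vector Carrierᴹ k) {w} →
      (∀ i → ⟨ v i , w ⟩ ≈ 0#) → ⟨ lincomb c v , w ⟩ ≈ 0#
    ⟨⟩-lincomb≈0 {zero}  c v {w} v⊥w = trans (⟨⟩-cong (≈ᴹ-sym (*ₗ-zeroˡ 0ᴹ)) ≈ᴹ-refl)
      (trans (*-linearˡ 0# 0ᴹ w) (zeroˡ _))
    ⟨⟩-lincomb≈0 {suc k} c v {w} v⊥w = trans (+-linearˡ _ _ w)
      (trans (+-cong (trans (*-linearˡ (c zero) (v zero) w) (trans (*-congˡ (v⊥w zero)) (zeroʳ _)))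
                     (⟨⟩-lincomb≈0 (c ∘ suc) (v ∘ suc) (v⊥w ∘ suc)))
        (+-identityˡ 0#))

    ⟨⟩-InSpan≈0 : ∀ {k} (v : Vector Carrierᴹ k) {w} →
      (∀ i → ⟨ v i , w ⟩ ≈ 0#) → ∀ {x} → InSpan v x → ⟨ x , w ⟩ ≈ 0#
    ⟨⟩-InSpan≈0 v v⊥w (c , e) = trans (⟨⟩-cong (≈ᴹ-sym e) ≈ᴹ-refl) (⟨⟩-lincomb≈0 c v v⊥w)

    ⟨⟩-difference≈0 : ∀ v {x y} → ⟨ v , x ⟩ ≈ ⟨ v , y ⟩ → ⟨ v , x +ᴹ -ᴹ y ⟩ ≈ 0#
    ⟨⟩-difference≈0 v {x} {y} eq = begin
      ⟨ v , x +ᴹ -ᴹ y ⟩              ≈⟨ +-linearʳ v x (-ᴹ y) ⟩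
      ⟨ v , x ⟩ + ⟨ v , -ᴹ y ⟩       ≈⟨ +-congʳ eq ⟩
      ⟨ v , y ⟩ + ⟨ v , -ᴹ y ⟩       ≈⟨ +-linearʳ v y (-ᴹ y) ⟨
      ⟨ v , y +ᴹ -ᴹ y ⟩              ≈⟨ ⟨⟩-cong ≈ᴹ-refl (≈ᴹ-trans (-ᴹ‿inverseʳ y) (≈ᴹ-sym (*ₗ-zeroˡ y))) ⟩
      ⟨ v , 0# *ₗ y ⟩                ≈⟨ *-linearʳ 0# v y ⟩
      0# * ⟨ v , y ⟩                 ≈⟨ zeroˡ _ ⟩
      0#                             ∎
      where open SetoidReasoning setoid

    -- Sending `c` to the values of `⟨ b j , lincomb c a ⟩` is linear, so a trivial kernel makes it
    -- an injection from F^k to F^m.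
    pairing⇒≤ : ∀ {k m} (a : Vector Carrierᴹ k) (b : Vector Carrierᴹ m) →
      (∀ c → (∀ j → ⟨ b j , lincomb c a ⟩ ≈ 0#) → ∀ i → c i ≈ 0#) → k ≤ℕ m
    pairing⇒≤ a b trivialKernel = injection⇒≤ (λ c j → ⟨ b j , lincomb c a ⟩) λ c d eq i →
      x∙y⁻¹≈ε⇒x≈y (c i) (d i) (trivialKernel (λ i → c i - d i)
        (λ j → trans (⟨⟩-cong ≈ᴹ-refl (lincomb-- {E = E} c d a)) (⟨⟩-difference≈0 (b j) (eq j))) i)
      where open AbelianGroupProperties +-abelianGroup using (x∙y⁻¹≈ε⇒x≈y)

    orthogonal-swap : ∀ {V W : Subspace E} → V ⊆ orthogonal B W → W ⊆ orthogonal B V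
    orthogonal-swap V⊆W⊥ w w∈W v v∈V = trans (symmetric v w) (V⊆W⊥ v v∈V w w∈W)

    orthogonal-antitone : ∀ {V W : Subspace E} → V ⊆ W → orthogonal B W ⊆ orthogonal B V
    orthogonal-antitone V⊆W x x⊥W v v∈V = x⊥W v (V⊆W v v∈V)

    -- Pairing V with a complement of V⊥ is nondegenerate on both sides.
    dim-orthogonal : ∀ V → dim V +ℕ dim (orthogonal B V) ≡ dim (whole E)
    dim-orthogonal V = ℕ.≤-antisym
      (ℕ.≤-trans (ℕ.+-monoˡ-≤ (dim V⊥) dimV≤) (extension-dim≤ {V = V⊥} {W = whole E} (λ _ _ → tt) X))
      (ℕ.≤-trans (spanning⇒dim≤ (whole E) X.spanning) (ℕ.+-monoˡ-≤ (dim V⊥) ≤dimV))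
      where
      V⊥ = orthogonal B V
      module V = Basis (chooseBasis V)
      module V⊥ = Basis (chooseBasis V⊥)
      X = extend V⊥.independent (whole E)
      module X = Extension X

      ≤dimV : X.extra ≤ℕ dim V
      -- A combination of the added vectors that is orthogonal to a basis of V lies in V⊥, modulo
      -- which these vectors are independent.
      ≤dimV = pairing⇒≤ X.vector V.vector λ c eq → X.independent-modulo c
        (V⊥.spanning _ λ v v∈V → ⟨⟩-InSpan≈0 V.vector eq (V.spanning v v∈V))

      dimV≤ : dim V ≤ℕ X.extra
      -- A vector of V is already orthogonal to V⊥; if it is also orthogonal to the complement, it
      -- is orthogonal to all of E.
      dimV≤ = pairing⇒≤ V.vector X.vector λ c eq → V.independent c
        (nondegenerate (lincomb c V.vector) λ w → trans (symmetric _ w)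
          (⟨⟩-InSpan≈0 (X.vector Vector.++ V⊥.vector) (orthogonal-to c eq) (X.spanning w tt)))
        where
        orthogonal-to : ∀ c → (∀ j → ⟨ X.vector j , lincomb c V.vector ⟩ ≈ 0#) →
          ∀ i → ⟨ (X.vector Vector.++ V⊥.vector) i , lincomb c V.vector ⟩ ≈ 0#
        orthogonal-to c eq i with splitAt X.extra i
        ... | inj₁ j = eq j
        ... | inj₂ j = trans (symmetric _ _)
          (V⊥.inside j _ (lincomb-closed V c V.vector V.inside))

  -- Minima over subspaces and the growth of rank.

  -- Subspaces are predicates with data, so mutual inclusion is weaker than propositional equality,
  -- and `subspaces` lists every subspace only up to mutual inclusion.
  Extensional : ∀ {E : VectorSpace F} → RankFunction E → Set₁
  Extensional {E} f = ∀ (V W : Subspace E) → V ⊆ W → W ⊆ V → f V ≡ f W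

  module _ {E : VectorSpace F} where

    dim-extensional : ∀ (V W : Subspace E) → V ⊆ W → W ⊆ V → dim V ≡ dim W
    dim-extensional V W V⊆W W⊆V = ℕ.≤-antisym (dim-mono {V = V} {W} V⊆W) (dim-mono {V = W} {V} W⊆V)

    min-attained : ∀ f (V : Subspace E) → ∃ λ X → X ⊆ V × f X ≡ min-over-subspaces f V
    min-attained f V with argmin-sel id (f V) (map f (filter (_⊆? V) subspaces))
    -- The default candidate of `min` is `f V`, attained at V itself.
    ... | inj₁ eq = V , (λ _ p → p) , ≡.sym eq
    ... | inj₂ m∈ with ∈-map∘filter⁻ f (_⊆? V) {xs = subspaces} m∈
    ... | X , _ , eq , X⊆V = X , X⊆V , ≡.sym eq

    -- The minimum is compared with `f W` for a listed W that has the same elements as X;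
    -- extensionality carries the bound over to X.
    min≤ : ∀ {f} → Extensional f → ∀ {X V : Subspace E} → X ⊆ V → min-over-subspaces f V ≤ᶻ f X
    min≤ {f} f-ext {X} {V} X⊆V with subspaces-complete X
    ... | W , W∈ , X⊆W , W⊆X = ≡.subst (min-over-subspaces f V ≤ᶻ_) (f-ext W X W⊆X X⊆W)
      (All.lookup (min≤xs (f V) (map f (filter (_⊆? V) subspaces)))
        (∈-map∘filter⁺ f (_⊆? V) (W , W∈ , ≡.refl , λ x p → X⊆V x (W⊆X x p))))

    module _ (M : QMatroid E) where
      open QMatroid M

      ρ-extensional : Extensional ρ
      ρ-extensional V W V⊆W W⊆V = ℤ.≤-antisym (monotone V W V⊆W) (monotone W V W⊆V)

      -- Let S be spanned by the vectors that extend a basis of V to one of W. Then W ≤ S + V, and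
      -- submodularity with ρ(S ∩ V) ≥ 0 bounds ρ(W) - ρ(V) by ρ(S), hence by the number of added
      -- vectors.
      ρ-increase : ∀ {V W : Subspace E} → V ⊆ W → ρ W +ᶻ pos (dim V) ≤ᶻ ρ V +ᶻ pos (dim W)
      ρ-increase {V} {W} V⊆W = rank-increase-bound (ρ W) (ρ V) (pos X.extra) (pos (dim V)) (pos (dim W))
        ρW≤ (+≤+ (extension-dim≤ {V = V} {W} V⊆W X))
        where
        open ℤ.≤-Reasoning
        open VectorSpace E using (lincomb)
        module V = Basis (chooseBasis V)
        X = extend V.independent W
        module X = Extension X
        S = span X.vector

        W⊆S∔V : W ⊆ S ∔ V
        W⊆S∔V x x∈W with X.split (X.spanning x x∈W)
        ... | c , d , e = lincomb c X.vector , lincomb d V.vector , (c , VectorSpace.≈ᴹ-refl E)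
                        , lincomb-closed V d V.vector V.inside , e

        ρW≤ : ρ W ≤ᶻ pos X.extra +ᶻ ρ V
        ρW≤ = begin
          ρ W                            ≤⟨ monotone W (S ∔ V) W⊆S∔V ⟩
          ρ (S ∔ V)                      ≡⟨ ℤ.+-identityʳ _ ⟨
          ρ (S ∔ V) +ᶻ 0ℤ                ≤⟨ ℤ.+-monoʳ-≤ (ρ (S ∔ V)) (nonnegative (S ∩ V)) ⟩
          ρ (S ∔ V) +ᶻ ρ (S ∩ V)         ≤⟨ submodular S V ⟩
          ρ S +ᶻ ρ V                     ≤⟨ ℤ.+-monoˡ-≤ (ρ V) (ℤ.≤-trans (bounded S) (+≤+ (spanning⇒dim≤ S (λ _ p → p)))) ⟩
          pos X.extra +ᶻ ρ V             ∎

    dual-extensional : ∀ {ρ} (B : NondegenerateSymmetricForm E) → Extensional ρ → Extensional (ρ *[ B ])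
    dual-extensional {ρ} B ρ-ext V W V⊆W W⊆V = ≡.cong₂ (λ d r → pos d +ᶻ r -ᶻ ρ (whole E))
      (dim-extensional V W V⊆W W⊆V)
      (ρ-ext (orthogonal B V) (orthogonal B W)
        (orthogonal-antitone B {W} {V} W⊆V) (orthogonal-antitone B {V} {W} V⊆W))

  -- Products and projections of subspaces in a direct sum.

  infixr 7 _⊠_

  _⊠_ : ∀ {E₁ E₂ : VectorSpace F} → Subspace E₁ → Subspace E₂ → Subspace (E₁ ⊕ⱽ E₂)
  V₁ ⊠ V₂ = record
    { Member   = λ (x , y) → x ∈ V₁ × y ∈ V₂
    ; member?  = λ (x , y) → V₁.member? x ×-dec V₂.member? y
    ; respects = λ (e₁ , e₂) (p , q) → V₁.respects e₁ p , V₂.respects e₂ q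
    ; 0-closed = V₁.0-closed , V₂.0-closed
    ; +-closed = λ (p , q) (r , s) → V₁.+-closed p r , V₂.+-closed q s
    ; *-closed = λ a (p , q) → V₁.*-closed a p , V₂.*-closed a q
    }
    where
    module V₁ = Subspace V₁
    module V₂ = Subspace V₂

  module _ {E₁ E₂ : VectorSpace F} where
    private
      module E₁ = VectorSpace E₁
      module E₂ = VectorSpace E₂
      module E = VectorSpace (E₁ ⊕ⱽ E₂)

    -- The summands cannot be inferred from an argument of type Subspace (E₁ ⊕ⱽ E₂).
    pr₁ : Subspace (E₁ ⊕ⱽ E₂) → Subspace E₁
    pr₁ = π₁ {E₁ = E₁} {E₂}

    pr₂ : Subspace (E₁ ⊕ⱽ E₂) → Subspace E₂
    pr₂ = π₂ {E₁ = E₁} {E₂}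

    inl : ∀ {k} → Vector E₁.Carrierᴹ k → Vector E.Carrierᴹ k
    inl v i = v i , E₂.0ᴹ

    inr : ∀ {k} → Vector E₂.Carrierᴹ k → Vector E.Carrierᴹ k
    inr w i = E₁.0ᴹ , w i

    lincomb-inl : ∀ {k} c (v : Vector E₁.Carrierᴹ k) → E.lincomb c (inl v) E.≈ᴹ (E₁.lincomb c v , E₂.0ᴹ)
    lincomb-inl {zero}  c v = E₁.≈ᴹ-refl , E₂.≈ᴹ-refl
    lincomb-inl {suc k} c v =
      E₁.+ᴹ-congˡ (proj₁ rest) ,
      E₂.≈ᴹ-trans (E₂.+ᴹ-cong (E₂.*ₗ-zeroʳ (c zero)) (proj₂ rest)) (E₂.+ᴹ-identityˡ _)
      where rest = lincomb-inl (c ∘ suc) (v ∘ suc)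

    lincomb-inr : ∀ {k} c (w : Vector E₂.Carrierᴹ k) → E.lincomb c (inr w) E.≈ᴹ (E₁.0ᴹ , E₂.lincomb c w)
    lincomb-inr {zero}  c w = E₁.≈ᴹ-refl , E₂.≈ᴹ-refl
    lincomb-inr {suc k} c w =
      E₁.≈ᴹ-trans (E₁.+ᴹ-cong (E₁.*ₗ-zeroʳ (c zero)) (proj₁ rest)) (E₁.+ᴹ-identityˡ _) ,
      E₂.+ᴹ-congˡ (proj₂ rest)
      where rest = lincomb-inr (c ∘ suc) (w ∘ suc)

    lincomb-inl++inr : ∀ {j k} c (v : Vector E₁.Carrierᴹ j) (w : Vector E₂.Carrierᴹ k) →
      E.lincomb c (inl v Vector.++ inr w) E.≈ᴹ
      (E₁.lincomb (c ∘ (_↑ˡ k)) v , E₂.lincomb (c ∘ (j ↑ʳ_)) w)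
    lincomb-inl++inr {j} {k} c v w =
      E₁.≈ᴹ-trans (proj₁ sums) (E₁.≈ᴹ-trans (E₁.+ᴹ-cong (proj₁ l) (proj₁ r)) (E₁.+ᴹ-identityʳ _)) ,
      E₂.≈ᴹ-trans (proj₂ sums) (E₂.≈ᴹ-trans (E₂.+ᴹ-cong (proj₂ l) (proj₂ r)) (E₂.+ᴹ-identityˡ _))
      where
      sums = E.lincomb-++ c (inl v) (inr w)
      l = lincomb-inl (c ∘ (_↑ˡ k)) v
      r = lincomb-inr (c ∘ (j ↑ʳ_)) w

    -- Bases of the factors, padded with zero in the other coordinate, are jointly independent.
    dim-⊠ : ∀ (V₁ : Subspace E₁) (V₂ : Subspace E₂) → dim V₁ +ℕ dim V₂ ≤ℕ dim (V₁ ⊠ V₂)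
    dim-⊠ V₁ V₂ = independent⇒≤dim (V₁ ⊠ V₂) independent
      (++-inside (V₁ ⊠ V₂) (inl V₁.vector) (inr V₂.vector)
        (λ i → V₁.inside i , Subspace.0-closed V₂)
        (λ i → Subspace.0-closed V₁ , V₂.inside i))
      where
      module V₁ = Basis (chooseBasis V₁)
      module V₂ = Basis (chooseBasis V₂)

      independent : E.LinearlyIndependent (inl V₁.vector Vector.++ inr V₂.vector)
      independent c (eq₁ , eq₂) i =
        ≡.subst (λ j → c j ≈ 0#) (join-splitAt (dim V₁) (dim V₂) i) (at (splitAt (dim V₁) i))
        where
        split = lincomb-inl++inr c V₁.vector V₂.vector

        at : ∀ s → c (join (dim V₁) (dim V₂) s) ≈ 0#
        at (inj₁ j) = V₁.independent _ (E₁.≈ᴹ-trans (E₁.≈ᴹ-sym (proj₁ split)) eq₁) j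
        at (inj₂ j) = V₂.independent _ (E₂.≈ᴹ-trans (E₂.≈ᴹ-sym (proj₂ split)) eq₂) j

    -- Padded bases of the two projections span their product, which contains V. They need not lie
    -- in V, and `spanning⇒dim≤` does not ask for that.
    dim≤dim-projections : ∀ (V : Subspace (E₁ ⊕ⱽ E₂)) → dim V ≤ℕ dim (pr₁ V) +ℕ dim (pr₂ V)
    dim≤dim-projections V = spanning⇒dim≤ V {v = inl V₁.vector Vector.++ inr V₂.vector} λ (x , y) p →
      let (c , e₁) = V₁.spanning x ((x , y) , p , E₁.≈ᴹ-refl)
          (d , e₂) = V₂.spanning y ((x , y) , p , E₂.≈ᴹ-refl)
          s        = lincomb-inl++inr (c Vector.++ d) V₁.vector V₂.vector
      in c Vector.++ d ,
         ( E₁.≈ᴹ-trans (proj₁ s) (E₁.≈ᴹ-trans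
             (E₁.lincomb-cong (λ i → reflexive (lookup-++ˡ c d i)) (λ _ → E₁.≈ᴹ-refl)) e₁)
         , E₂.≈ᴹ-trans (proj₂ s) (E₂.≈ᴹ-trans
             (E₂.lincomb-cong (λ i → reflexive (lookup-++ʳ c d i)) (λ _ → E₂.≈ᴹ-refl)) e₂) )
      where
      module V₁ = Basis (chooseBasis (pr₁ V))
      module V₂ = Basis (chooseBasis (pr₂ V))

    -- The orthogonal sum of two forms.

    module _ (B₁ : NondegenerateSymmetricForm E₁) (B₂ : NondegenerateSymmetricForm E₂) where
      private
        module B₁ = NondegenerateSymmetricForm B₁
        module B₂ = NondegenerateSymmetricForm B₂
      open SetoidReasoning setoid

      ⊕ᶠ-isNondegenerateSymmetricBilinear : IsNondegenerateSymmetricBilinear (E₁ ⊕ⱽ E₂) (B₁ ⊕ᶠ B₂)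
      ⊕ᶠ-isNondegenerateSymmetricBilinear = record
        { cong          = λ (p₁ , p₂) (q₁ , q₂) → +-cong (B₁.cong p₁ q₁) (B₂.cong p₂ q₂)
        ; +-linearˡ     = λ (v₁ , v₂) (v₁′ , v₂′) (w₁ , w₂) →
            trans (+-cong (B₁.+-linearˡ v₁ v₁′ w₁) (B₂.+-linearˡ v₂ v₂′ w₂)) (interchange _ _ _ _)
        ; *-linearˡ     = λ a (v₁ , v₂) (w₁ , w₂) →
            trans (+-cong (B₁.*-linearˡ a v₁ w₁) (B₂.*-linearˡ a v₂ w₂)) (sym (distribˡ a _ _))
        ; +-linearʳ     = λ (v₁ , v₂) (w₁ , w₂) (w₁′ , w₂′) →
            trans (+-cong (B₁.+-linearʳ v₁ w₁ w₁′) (B₂.+-linearʳ v₂ w₂ w₂′)) (interchange _ _ _ _)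
        ; *-linearʳ     = λ a (v₁ , v₂) (w₁ , w₂) →
            trans (+-cong (B₁.*-linearʳ a v₁ w₁) (B₂.*-linearʳ a v₂ w₂)) (sym (distribˡ a _ _))
        ; symmetric     = λ (v₁ , v₂) (w₁ , w₂) → +-cong (B₁.symmetric v₁ w₁) (B₂.symmetric v₂ w₂)
        -- Testing against `(w , 0ᴹ)` and `(0ᴹ , w)` isolates the two forms. That the other summand
        -- vanishes is the closure under zero of an orthogonal space.
        ; nondegenerate = λ (v₁ , v₂) v⊥ →
            B₁.nondegenerate v₁ (λ w → begin
              B₁.form v₁ w                      ≈⟨ +-identityʳ _ ⟨
              B₁.form v₁ w + 0#                 ≈⟨ +-congˡ (Subspace.0-closed (orthogonal B₂ (whole E₂)) v₂ tt) ⟨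
              B₁.form v₁ w + B₂.form v₂ E₂.0ᴹ   ≈⟨ v⊥ (w , E₂.0ᴹ) ⟩
              0#                                ∎) ,
            B₂.nondegenerate v₂ (λ w → begin
              B₂.form v₂ w                      ≈⟨ +-identityˡ _ ⟨
              0# + B₂.form v₂ w                 ≈⟨ +-congʳ (Subspace.0-closed (orthogonal B₁ (whole E₁)) v₁ tt) ⟨
              B₁.form v₁ E₁.0ᴹ + B₂.form v₂ w   ≈⟨ v⊥ (E₁.0ᴹ , w) ⟩
              0#                                ∎)
        }
        where
        open CommutativeSemigroupProperties +-commutativeSemigroup using (interchange)

      ⊕ᴮ : NondegenerateSymmetricForm (E₁ ⊕ⱽ E₂)
      ⊕ᴮ = mkForm (B₁ ⊕ᶠ B₂) ⊕ᶠ-isNondegenerateSymmetricBilinear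

      -- The form on E is the sum of two terms, each pairing a vector of πᵢV with one orthogonal to
      -- πᵢV.
      orthogonal-projections : ∀ V → orthogonal B₁ (pr₁ V) ⊠ orthogonal B₂ (pr₂ V) ⊆ orthogonal ⊕ᴮ V
      orthogonal-projections V (w₁ , w₂) (w₁⊥ , w₂⊥) (v₁ , v₂) v∈V =
        trans (+-cong (w₁⊥ v₁ ((v₁ , v₂) , v∈V , E₁.≈ᴹ-refl)) (w₂⊥ v₂ ((v₁ , v₂) , v∈V , E₂.≈ᴹ-refl)))
          (+-identityˡ 0#)

    pr₁-⊆ : ∀ {V V₁} (V₂ : Subspace E₂) → V ⊆ V₁ ⊠ V₂ → pr₁ V ⊆ V₁
    pr₁-⊆ {V₁ = V₁} V₂ V⊆ x (v , v∈V , e) = Subspace.respects V₁ e (proj₁ (V⊆ v v∈V))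

    pr₂-⊆ : ∀ {V V₂} (V₁ : Subspace E₁) → V ⊆ V₁ ⊠ V₂ → pr₂ V ⊆ V₂
    pr₂-⊆ {V₂ = V₂} V₁ V⊆ x (v , v∈V , e) = Subspace.respects V₂ e (proj₂ (V⊆ v v∈V))

    -- The rank of a direct sum.

    -- The function minimised in `⊕`, named because it is used both for the given rank functions and
    -- for their duals.
    directSumTerm : RankFunction E₁ → RankFunction E₂ → RankFunction (E₁ ⊕ⱽ E₂)
    directSumTerm ρ₁ ρ₂ X = ρ₁ (pr₁ X) +ᶻ ρ₂ (pr₂ X) -ᶻ pos (dim X)

    pr₁-mono : ∀ {V W} → V ⊆ W → pr₁ V ⊆ pr₁ W
    pr₁-mono V⊆W x (v , v∈V , e) = v , V⊆W v v∈V , e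

    pr₂-mono : ∀ {V W} → V ⊆ W → pr₂ V ⊆ pr₂ W
    pr₂-mono V⊆W x (v , v∈V , e) = v , V⊆W v v∈V , e

    directSumTerm-extensional : ∀ {ρ₁ ρ₂} → Extensional ρ₁ → Extensional ρ₂ →
      Extensional (directSumTerm ρ₁ ρ₂)
    directSumTerm-extensional ext₁ ext₂ V W V⊆W W⊆V = ≡.cong₂ _-ᶻ_
      (≡.cong₂ _+ᶻ_
        (ext₁ (pr₁ V) (pr₁ W) (pr₁-mono {V} {W} V⊆W) (pr₁-mono {W} {V} W⊆V))
        (ext₂ (pr₂ V) (pr₂ W) (pr₂-mono {V} {W} V⊆W) (pr₂-mono {W} {V} W⊆V)))
      (≡.cong pos (dim-extensional V W V⊆W W⊆V))

    module _ (M₁ : QMatroid E₁) (M₂ : QMatroid E₂) where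
      private
        module M₁ = QMatroid M₁
        module M₂ = QMatroid M₂
      open QMatroid M₁ using () renaming (ρ to ρ₁)
      open QMatroid M₂ using () renaming (ρ to ρ₂)

      primalTerm = directSumTerm ρ₁ ρ₂

      primalTerm-extensional : Extensional primalTerm
      primalTerm-extensional = directSumTerm-extensional {ρ₁} {ρ₂} (ρ-extensional M₁) (ρ-extensional M₂)

      private
        E = whole (E₁ ⊕ⱽ E₂)
        r₁ = ρ₁ (whole E₁)
        r₂ = ρ₂ (whole E₂)
        e₁ = dim (whole E₁)
        e₂ = dim (whole E₂)

      -- The candidate X = E gives the upper bound. At any X, `ρ-increase` bounds ρᵢ(Eᵢ) - ρᵢ(πᵢX)
      -- by dim Eᵢ - dim πᵢX, and dim X ≤ dim π₁X + dim π₂X gives the lower bound.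
      ⊕-rank : (ρ₁ ⊕ ρ₂) E ≡ r₁ +ᶻ r₂
      ⊕-rank = let (X , _ , X-min) = min-attained primalTerm E in
        ℤ.≤-antisym upper (≡.subst (λ m → r₁ +ᶻ r₂ ≤ᶻ pos (dim E) +ᶻ m) X-min (lower X))
        where
        upper : (ρ₁ ⊕ ρ₂) E ≤ᶻ r₁ +ᶻ r₂
        upper = begin
          pos (dim E) +ᶻ min-over-subspaces primalTerm E
            ≤⟨ ℤ.+-monoʳ-≤ (pos (dim E)) (min≤ {f = primalTerm} primalTerm-extensional {E} {E} (λ _ p → p)) ⟩
          pos (dim E) +ᶻ (ρ₁ (pr₁ E) +ᶻ ρ₂ (pr₂ E) -ᶻ pos (dim E))
            ≡⟨ minus-cancel-+ (pos (dim E)) (ρ₁ (pr₁ E) +ᶻ ρ₂ (pr₂ E)) ⟩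
          ρ₁ (pr₁ E) +ᶻ ρ₂ (pr₂ E)
            ≤⟨ ℤ.+-mono-≤ (M₁.monotone (pr₁ E) _ (λ _ _ → tt)) (M₂.monotone (pr₂ E) _ (λ _ _ → tt)) ⟩
          r₁ +ᶻ r₂ ∎
          where open ℤ.≤-Reasoning

        lower : ∀ X → r₁ +ᶻ r₂ ≤ᶻ pos (dim E) +ᶻ primalTerm X
        lower X = full-rank-bound r₁ r₂ (pos (dim E)) (ρ₁ (pr₁ X)) (ρ₂ (pr₂ X)) (pos (dim X))
          (pos (dim (pr₁ X))) (pos (dim (pr₂ X))) (pos e₁) (pos e₂)
          (ρ-increase M₁ {pr₁ X} {whole E₁} (λ _ _ → tt))
          (ρ-increase M₂ {pr₂ X} {whole E₂} (λ _ _ → tt))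
          (+≤+ (ℕ.≤-trans (dim-⊠ (whole E₁) (whole E₂))
            (dim-mono {V = whole E₁ ⊠ whole E₂} {E} (λ _ _ → tt))))
          (+≤+ (dim≤dim-projections X))

      -- Duality between the two minima.

      module _ (B₁ : NondegenerateSymmetricForm E₁) (B₂ : NondegenerateSymmetricForm E₂) where

        private
          B = ⊕ᴮ B₁ B₂
          dualTerm = directSumTerm (ρ₁ *[ B₁ ]) (ρ₂ *[ B₂ ])

        dualTerm-extensional : Extensional dualTerm
        dualTerm-extensional = directSumTerm-extensional {ρ₁ *[ B₁ ]} {ρ₂ *[ B₂ ]}
          (dual-extensional B₁ (ρ-extensional M₁)) (dual-extensional B₂ (ρ-extensional M₂))

        -- This is the orthogonal space of `pr₁ X ⊠ pr₂ X`, hence the largest product of subspaces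
        -- inside X⊥.
        projections⊥ : Subspace (E₁ ⊕ⱽ E₂) → Subspace (E₁ ⊕ⱽ E₂)
        projections⊥ X = orthogonal B₁ (pr₁ X) ⊠ orthogonal B₂ (pr₂ X)

        -- Both `W` and `projections⊥ U` lie in U⊥, so their sum does too, and modularity bounds
        -- their intersection from below. This makes the matched candidate large enough in both
        -- directions of the duality.
        dim-projections⊥ : ∀ {U W : Subspace (E₁ ⊕ⱽ E₂)} → W ⊆ orthogonal B U →
          dim W +ℕ (dim (orthogonal B₁ (pr₁ U)) +ℕ dim (orthogonal B₂ (pr₂ U))) ≤ℕ
          dim (orthogonal B U) +ℕ dim (W ∩ projections⊥ U)
        dim-projections⊥ {U} {W} W⊆U⊥ = begin
          dim W +ℕ (dim (orthogonal B₁ (pr₁ U)) +ℕ dim (orthogonal B₂ (pr₂ U)))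
            ≤⟨ ℕ.+-monoʳ-≤ (dim W) (dim-⊠ (orthogonal B₁ (pr₁ U)) (orthogonal B₂ (pr₂ U))) ⟩
          dim W +ℕ dim (projections⊥ U)
            ≤⟨ dim-modular W (projections⊥ U) ⟩
          dim (W ∔ projections⊥ U) +ℕ dim (W ∩ projections⊥ U)
            ≤⟨ ℕ.+-monoˡ-≤ _ (dim-mono {V = W ∔ projections⊥ U} {orthogonal B U}
                 (∔-least {U = orthogonal B U} W (projections⊥ U) W⊆U⊥ (orthogonal-projections B₁ B₂ U))) ⟩
          dim (orthogonal B U) +ℕ dim (W ∩ projections⊥ U) ∎
          where open ℕ.≤-Reasoning

        -- The matched Y satisfies πᵢY ≤ (πᵢX)⊥, so monotonicity compares the ranks; the rest is a
        -- comparison of dimensions.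
        primalMin≤dualTerm : ∀ {V X} → X ⊆ V →
          pos (dim (orthogonal B V)) +ᶻ min-over-subspaces primalTerm (orthogonal B V) ≤ᶻ
          dualTerm X +ᶻ (r₁ +ᶻ r₂)
        primalMin≤dualTerm {V} {X} X⊆V = ℤ.≤-trans
          (ℤ.+-monoʳ-≤ (pos (dim V⊥)) (min≤ {f = primalTerm} primalTerm-extensional {Y} {V⊥} (λ _ → proj₁)))
          (primal-bound (pos (dim V⊥)) (pos (dim Y)) (pos (dim X)) (pos (dim (orthogonal B X)))
            (pos (dim E)) (pos e₁) (pos e₂) (pos (dim (pr₁ X))) (pos (dim (pr₂ X)))
            (pos (dim X₁⊥)) (pos (dim X₂⊥)) (ρ₁ X₁⊥) (ρ₂ X₂⊥) (ρ₁ (pr₁ Y)) (ρ₂ (pr₂ Y)) r₁ r₂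
            (M₁.monotone (pr₁ Y) X₁⊥ (pr₁-⊆ {V = Y} {X₁⊥} (orthogonal B₂ (pr₂ X)) (λ _ → proj₂)))
            (M₂.monotone (pr₂ Y) X₂⊥ (pr₂-⊆ {V = Y} {X₂⊥} (orthogonal B₁ (pr₁ X)) (λ _ → proj₂)))
            (+≤+ (dim-projections⊥ {X} {V⊥} (orthogonal-antitone B {X} {V} X⊆V)))
            (ℤ.≤-reflexive (≡.cong pos (dim-orthogonal B X)))
            (+≤+ (ℕ.≤-trans (dim≤dim-projections E) (ℕ.+-mono-≤
              (dim-mono {V = pr₁ E} {whole E₁} (λ _ _ → tt)) (dim-mono {V = pr₂ E} {whole E₂} (λ _ _ → tt)))))
            (ℤ.≤-reflexive (≡.cong pos (≡.sym (dim-orthogonal B₁ (pr₁ X)))))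
            (ℤ.≤-reflexive (≡.cong pos (≡.sym (dim-orthogonal B₂ (pr₂ X))))))
          where
          V⊥ = orthogonal B V
          X₁⊥ = orthogonal B₁ (pr₁ X)
          X₂⊥ = orthogonal B₂ (pr₂ X)
          Y = V⊥ ∩ projections⊥ X

        -- For the matched X the inclusion is again πᵢY ≤ (πᵢX)⊥, but now ρᵢ((πᵢX)⊥) has to be
        -- bounded above by ρᵢ(πᵢY). Monotonicity points the wrong way, and `ρ-increase` bounds the
        -- excess by a difference of dimensions.
        dualMin≤primalTerm : ∀ {V Y} → Y ⊆ orthogonal B V →
          min-over-subspaces dualTerm V +ᶻ (r₁ +ᶻ r₂) ≤ᶻ pos (dim (orthogonal B V)) +ᶻ primalTerm Y
        dualMin≤primalTerm {V} {Y} Y⊆V⊥ = ℤ.≤-trans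
          (ℤ.+-monoˡ-≤ (r₁ +ᶻ r₂) (min≤ {f = dualTerm} dualTerm-extensional {X} {V} (λ _ → proj₁)))
          (dual-bound (pos (dim V)) (pos (dim (orthogonal B V)))
            (pos (dim Y)) (pos (dim (orthogonal B Y))) (pos (dim X))
            (pos (dim (pr₁ X))) (pos (dim (pr₂ X))) (pos (dim X₁⊥)) (pos (dim X₂⊥))
            (pos (dim (pr₁ Y))) (pos (dim (pr₂ Y)))
            (pos (dim (orthogonal B₁ (pr₁ Y)))) (pos (dim (orthogonal B₂ (pr₂ Y))))
            (ρ₁ X₁⊥) (ρ₂ X₂⊥) (ρ₁ (pr₁ Y)) (ρ₂ (pr₂ Y)) r₁ r₂
            (ρ-increase M₁ {pr₁ Y} {orthogonal B₁ (pr₁ X)} (orthogonal-swap B₁ {pr₁ X} {pr₁ Y}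
              (pr₁-⊆ {V = X} {orthogonal B₁ (pr₁ Y)} (orthogonal B₂ (pr₂ Y)) (λ _ → proj₂))))
            (ρ-increase M₂ {pr₂ Y} {orthogonal B₂ (pr₂ X)} (orthogonal-swap B₂ {pr₂ X} {pr₂ Y}
              (pr₂-⊆ {V = X} {orthogonal B₂ (pr₂ Y)} (orthogonal B₁ (pr₁ Y)) (λ _ → proj₂))))
            (ℤ.≤-reflexive (≡.cong pos (≡.trans
              (dim-orthogonal B₁ (pr₁ X)) (≡.sym (dim-orthogonal B₁ (pr₁ Y))))))
            (ℤ.≤-reflexive (≡.cong pos (≡.trans
              (dim-orthogonal B₂ (pr₂ X)) (≡.sym (dim-orthogonal B₂ (pr₂ Y))))))
            (+≤+ (dim-projections⊥ {Y} {V} (orthogonal-swap B {Y} {V} Y⊆V⊥)))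
            (ℤ.≤-reflexive (≡.cong pos (≡.trans (dim-orthogonal B Y) (≡.sym (dim-orthogonal B V))))))
          where
          X = V ∩ projections⊥ Y
          X₁⊥ = orthogonal B₁ (pr₁ X)
          X₂⊥ = orthogonal B₂ (pr₂ X)

        min-duality : ∀ V →
          pos (dim (orthogonal B V)) +ᶻ min-over-subspaces primalTerm (orthogonal B V) ≡
          min-over-subspaces dualTerm V +ᶻ (r₁ +ᶻ r₂)
        min-duality V =
          let (X , X⊆V  , X-min) = min-attained dualTerm V
              (Y , Y⊆V⊥ , Y-min) = min-attained primalTerm (orthogonal B V)
          -- Each inequality is taken at a minimiser of the side that it bounds from below.
          in ℤ.≤-antisym
            (≡.subst (λ m → primal ≤ᶻ m +ᶻ (r₁ +ᶻ r₂)) X-min (primalMin≤dualTerm {V} {X} X⊆V))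
            (≡.subst (λ m → dual ≤ᶻ pos (dim (orthogonal B V)) +ᶻ m) Y-min (dualMin≤primalTerm {V} {Y} Y⊆V⊥))
          where
          primal = pos (dim (orthogonal B V)) +ᶻ min-over-subspaces primalTerm (orthogonal B V)
          dual   = min-over-subspaces dualTerm V +ᶻ (r₁ +ᶻ r₂)

        ⊕-dual : (ρ₁ ⊕ ρ₂) *[ B ] ≗ (ρ₁ *[ B₁ ]) ⊕ (ρ₂ *[ B₂ ])
        ⊕-dual V = begin
          pos (dim V) +ᶻ (ρ₁ ⊕ ρ₂) (orthogonal B V) -ᶻ (ρ₁ ⊕ ρ₂) E
            -- By definition `(ρ₁ ⊕ ρ₂) (orthogonal B V)` is the left side of `min-duality`; the
            -- constant on the right side is the rank of E, and the two cancel.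
            ≡⟨ ≡.cong₂ (λ a b → pos (dim V) +ᶻ a -ᶻ b) (min-duality V) ⊕-rank ⟩
          pos (dim V) +ᶻ (min-over-subspaces dualTerm V +ᶻ (r₁ +ᶻ r₂)) -ᶻ (r₁ +ᶻ r₂)
            ≡⟨ +-cancel-minus (pos (dim V)) (min-over-subspaces dualTerm V) (r₁ +ᶻ r₂) ⟩
          pos (dim V) +ᶻ min-over-subspaces dualTerm V ∎
          where open ≡.≡-Reasoning

theorem5p10 :
    (F : FiniteField) (E₁ E₂ : VectorSpace F)
    (M₁ : QMatroid E₁) (M₂ : QMatroid E₂)
    (B₁ : NondegenerateSymmetricForm E₁) (B₂ : NondegenerateSymmetricForm E₂) →
    let open QMatroid M₁ using () renaming (ρ to ρ₁)
        open QMatroid M₂ using () renaming (ρ to ρ₂)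
    in
    Σ (IsNondegenerateSymmetricBilinear (E₁ ⊕ⱽ E₂) (B₁ ⊕ᶠ B₂)) λ proof →
      (ρ₁ ⊕ ρ₂) *[ mkForm (B₁ ⊕ᶠ B₂) proof ] ≗ (ρ₁ *[ B₁ ]) ⊕ (ρ₂ *[ B₂ ])
theorem5p10 F E₁ E₂ M₁ M₂ B₁ B₂ = ⊕ᶠ-isNondegenerateSymmetricBilinear B₁ B₂ , ⊕-dual M₁ M₂ B₁ B₂
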